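{- For every Helly graph $G$, $\tau(G)\le 2hb(G)\le \tau(G)+1$. Furthermore, $2hb(G)=\tau(G)+1$ if and only if $\tau(G)$ is odd and $G$ contains the graph $H_3^{k}$ with $k=\lfloor \tau(G)/2\rfloor$ as an isometric subgraph.
   Context: Graphs are finite, connected, unweighted, undirected and simple; $d$ is the shortest-path distance. A subgraph is isometric if it is induced and distance-preserving. A graph is Helly if every family of pairwise intersecting disks $D(v,r)=\{u:d(u,v)\le r\}$ has a common vertex. $hb(G)$ is the maximum over quadruples $u,v,w,x$ of one half of the difference between the two largest of $d(u,v)+d(w,x)$, $d(u,w)+d(v,x)$, $d(u,x)+d(v,w)$. $I(x,y)=\{z: d(x,z)+d(z,y)=d(x,y)\}$, $S_j(x,y)=\{z\in I(x,y): d(x,z)=j\}$, and $\tau(G)=\max\{d(u,v): u,v\in S_j(x,y),\ x,y\in V(G),\ j\in\mathbb{N}\}$. King-grid: the graph on $\mathbb{Z}^2$ in which distinct $(x,y),(x',y')$ are adjacent iff $\max(|x-x'|,|y-y'|)=1$; for $u=(x,y)$ let $s(u)=x+y$, $t(u)=x-y$. For an integer $k\ge0$, $H_3^{k}$ is the subgraph of the King-grid induced by $\{u: 0\le s(u)\le 2k+2,\ -1\le t(u)\le 2k+1\}\cup\{(k,-k-1),(-1,1),(k+1,k+2),(2k+2,0)\}$. -}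

module Defs where

open import Data.Bool using (Bool; true; false; _∧_; _∨_; if_then_else_; T)
open import Data.Nat as ℕ using (ℕ; zero; suc; _+_; _∸_; _⊔_; _⊓_; _≤_; _≡ᵇ_)
open import Data.Integer as ℤ using (ℤ; +_; -[1+_]; ∣_∣)
open import Data.Fin using (Fin)
open import Data.List using (List; []; _∷_; map; filter; foldr; length; upTo; concatMap)
open import Data.Bool.ListAction using (any)
open import Data.List.Membership.Propositional using (_∈_)
open import Data.Fin.Properties using (_≟_)
open import Data.List.Base using (allFin)
open import Data.Product using (Σ; ∃; _×_; _,_; proj₁; proj₂)
open import Relation.Nullary.Decidable using (⌊_⌋)
open import Relation.Binary.PropositionalEquality using (_≡_)

module Dist {V : Set} (vs : List V) (adj : V → V → Bool) (eq : V → V → Bool) where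

  ball : ℕ → V → V → Bool
  ball zero    u v = eq u v
  ball (suc k) u v = ball k u v ∨ any (λ w → ball k u w ∧ adj w v) vs

  -- least i < b with f i = true, or b if there is none
  least : (ℕ → Bool) → ℕ → ℕ
  least f zero    = zero
  least f (suc b) = if f zero then zero else suc (least (λ i → f (suc i)) b)

  -- shortest-path distance (for vertices in the same component; the
  -- distance is at most (length vs ∸ 1) < length vs, so the bound suffices)
  dist : V → V → ℕ
  dist u v = least (λ k → ball k u v) (length vs)

data Walk {n : ℕ} (adj : Fin n → Fin n → Bool) : Fin n → Fin n → ℕ → Set where
  here : ∀ {u} → Walk adj u u zero
  step : ∀ {u w v k} → adj u w ≡ true → Walk adj w v k → Walk adj u v (suc k)

record Graph : Set where
  field
    n         : ℕ
    adj       : Fin n → Fin n → Bool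
    adj-sym   : ∀ u v → adj u v ≡ adj v u
    adj-irr   : ∀ u → adj u u ≡ false
    connected : ∀ u v → ∃ λ k → Walk adj u v k

module _ (G : Graph) where
  open Graph G

  Vx : Set
  Vx = Fin n

  d : Vx → Vx → ℕ
  d = Dist.dist (allFin n) adj (λ u v → ⌊ u ≟ v ⌋)

  InDisk : Vx → Vx × ℕ → Set
  InDisk u (v , r) = d v u ≤ r

  -- Helly: every (finite, as a list; G is finite so this loses nothing)
  -- family of pairwise intersecting disks has a common vertex
  Helly : Set
  Helly = (F : List (Vx × ℕ)) →
          (∀ {D₁ D₂} → D₁ ∈ F → D₂ ∈ F → ∃ λ u → InDisk u D₁ × InDisk u D₂) →
          ∃ λ u → ∀ {D} → D ∈ F → InDisk u D

maxOver : {A : Set} → List A → (A → ℕ) → ℕ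
maxOver xs f = foldr (λ a m → f a ⊔ m) 0 xs

med3 : ℕ → ℕ → ℕ → ℕ
med3 a b c = (a ⊓ b) ⊔ ((a ⊔ b) ⊓ c)

topGap : ℕ → ℕ → ℕ → ℕ
topGap a b c = (a ⊔ b ⊔ c) ∸ med3 a b c

module _ (G : Graph) where
  open Graph G
  private
    vs = allFin n
    dG = d G

  -- twoHb G = 2 · hb(G)  (hb is a half-integer, so we work with its double)
  twoHb : ℕ
  twoHb = maxOver vs λ u → maxOver vs λ v → maxOver vs λ w → maxOver vs λ x →
            topGap (dG u v + dG w x) (dG u w + dG v x) (dG u x + dG v w)

  inI : Vx G → Vx G → Vx G → Bool
  inI x y z = (dG x z + dG z y) ≡ᵇ dG x y

  -- τ(G) = max d(u,v) over u,v ∈ S_j(x,y)  (j is forced to be d(x,u) = d(x,v));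
  -- value 0 when the condition fails (0 is attained anyway with u = v = x)
  τ : ℕ
  τ = maxOver vs λ x → maxOver vs λ y → maxOver vs λ u → maxOver vs λ v →
        if inI x y u ∧ inI x y v ∧ (dG x u ≡ᵇ dG x v) then dG u v else 0

Pt : Set
Pt = ℤ × ℤ

eqℤ : ℤ → ℤ → Bool
eqℤ a b = ⌊ a ℤ.≟ b ⌋

eqPt : Pt → Pt → Bool
eqPt (a , b) (c , e) = eqℤ a c ∧ eqℤ b e

kingAdj : Pt → Pt → Bool
kingAdj (x , y) (x' , y') = (∣ x ℤ.- x' ∣ ⊔ ∣ y ℤ.- y' ∣) ≡ᵇ 1

sP : Pt → ℤ
sP (x , y) = x ℤ.+ y

tP : Pt → ℤ
tP (x , y) = x ℤ.- y

ι : ℕ → ℤ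
ι k = + k

inH3 : ℕ → Pt → Bool
inH3 k u =
  ((+ 0 ℤ.≤ᵇ sP u) ∧ (sP u ℤ.≤ᵇ + (2 ℕ.* k + 2)) ∧
   (ℤ.- (+ 1) ℤ.≤ᵇ tP u) ∧ (tP u ℤ.≤ᵇ + (2 ℕ.* k + 1)))
  ∨ eqPt u (ι k , ℤ.- (ι k ℤ.+ + 1))
  ∨ eqPt u (ℤ.- (+ 1) , + 1)
  ∨ eqPt u (ι k ℤ.+ + 1 , ι k ℤ.+ + 2)
  ∨ eqPt u (+ (2 ℕ.* k + 2) , + 0)

range : ℤ → ℕ → List ℤ
range a len = map (λ i → a ℤ.+ + i) (upTo len)

-- bounding box: every vertex of H_3^k has -1 ≤ x ≤ 2k+2 and -k-1 ≤ y ≤ k+2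
box : ℕ → List Pt
box k = concatMap (λ x → map (λ y → (x , y)) (range (ℤ.- (ι k ℤ.+ + 1)) (2 ℕ.* k + 4)))
                  (range (ℤ.- (+ 1)) (2 ℕ.* k + 4))

H3verts : ℕ → List Pt
H3verts k = filter (λ u → T? (inH3 k u)) (box k)
  where
    open import Relation.Nullary using (Dec)
    open import Data.Bool.Properties using (T?)

dH3 : ℕ → Pt → Pt → ℕ
dH3 k = Dist.dist (H3verts k) kingAdj eqPt

-- G contains H_3^k as an isometric subgraph: there is a map from V(H_3^k)
-- into V(G) preserving distances (such a map is automatically injective and
-- its image induces a subgraph isomorphic to H_3^k)
IsometricH3 : ℕ → Graph → Set
IsometricH3 k G = Σ (Pt → Vx G) λ φ →
  ∀ {a b} → a ∈ H3verts k → b ∈ H3verts k → d G (φ a) (φ b) ≡ dH3 k a b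

{-# OPTIONS --safe #-}

-- Four vertices a, b, c, e with S = d(a,c) + d(b,e) the largest of the three sums
-- embed isometrically into ℤ² with the maximum metric, around a rectangle with
-- diagonal sides whose shorter side has length δ/2, where δ is the gap between S
-- and the second largest sum.  In a Helly graph the inverse of this embedding
-- extends to a 1-Lipschitz map on any finite set of lattice points, and it is
-- isometric on every geodesic chain from one of the four points to another.
-- Opposite corners of a square of side δ/2 in the rectangle form a slice of
-- diameter δ, provided enough of its corners are lattice points.  The only
-- obstruction is that δ is even, the rectangle is itself that square, and its
-- corners are not lattice points; then the lattice points around it form H₃ᵏ
-- with δ = 2k + 2, which still contains a slice of diameter δ - 1.

module Submission where

open import Defs
open import Data.Nat using (ℕ; suc; _≤_; _%_; ⌊_/2⌋)
open import Data.Product using (_×_)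
open import Relation.Binary.PropositionalEquality using (_≡_)
open import Function.Bundles using (_⇔_)
open import Data.Bool using (Bool; true; false; T; if_then_else_; _∧_)
open import Data.Bool.ListAction using (any; all)
open import Data.Bool.Properties using (T-∧; T-∨; T-≡; T?)
open import Data.Empty using (⊥-elim)
open import Data.Fin using (Fin; zero; suc; toℕ; #_)
import Data.Fin.Properties as Finₚ
open import Data.Integer as ℤ using (ℤ; +_; -[1+_]; ∣_∣; +≤+)
open import Data.Integer.DivMod using (_/ℕ_; _%ℕ_; a≡a%ℕn+[a/ℕn]*n; n%ℕd<d)
import Data.Integer.Properties as ℤₚ
open import Data.Integer.Tactic.RingSolver using (solve-∀)
open import Data.List as L using (List; []; _∷_; _++_; map; length; allFin)
open import Data.List.Membership.Propositional using (_∈_; find; lose)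
open import Data.List.Membership.Propositional.Properties
  using (∈-allFin; ∈-map⁺; ∈-map⁻; ∈-concatMap⁺; ∈-upTo⁺; ∈-filter⁺; ∈-filter⁻)
open import Data.List.Relation.Unary.All as All using (All; []; _∷_)
import Data.List.Relation.Unary.All.Properties as Allₚ
open import Data.List.Relation.Unary.AllPairs using (AllPairs; []; _∷_)
open import Data.List.Relation.Unary.Any as Any using (Any; here; there; index)
import Data.List.Relation.Unary.Any.Properties as Anyₚ
open import Data.Maybe as Maybe using (Maybe; just; nothing)
open import Data.Nat as ℕ using (zero; _<_; z≤n; s≤s)
open import Data.Nat.DivMod using ([m+kn]%n≡m%n)
import Data.Nat.Properties as ℕₚ
open import Data.Product using (∃; _,_; _,′_; proj₁; proj₂)
open import Data.Product.Properties using (≡-dec)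
open import Data.Sum using (_⊎_; inj₁; inj₂)
open import Data.Unit using (tt)
open import Data.Vec as V using (Vec; []; _∷_)
open import Data.Vec.N-ary using (N-ary; _$ⁿ_; ∀ⁿ; curryⁿ)
import Data.Vec.Properties as Vₚ
open import Function using (_∘_; Equivalence; mk⇔)
open import Relation.Binary.PropositionalEquality
  using (refl; sym; trans; cong; cong₂; subst; subst₂; module ≡-Reasoning)
open import Relation.Nullary using (Dec; yes; no; ¬_; contradiction)
open import Relation.Nullary.Decidable
  using (⌊_⌋; toWitness; fromWitness; _×-dec_; _⊎-dec_; _→-dec_; decidable-stable)

open Equivalence using (to; from)

-- Linear integer arithmetic

-- Write s = x + y and t = x - y; lattice points are the pairs (s, t) of equal parity. Put a at the
-- origin, let r = d(a,b) + d(a,e) - d(b,e), and let g ≤ g' be the excess of the largest sum over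
-- the second and over the third. The rectangle is r ≤ s ≤ r + g', -g ≤ t ≤ 0, and the lines that
-- bound it pass through e, b, c and a. A square of side g in these coordinates, which is g/2 in the
-- metric, can slide by g' - g in the direction of s. So only the parities of g and r and the
-- question whether g' = g matter. If g is odd, two opposite corners of the square s ≥ r at the end
-- of the rectangle are lattice points. If g is even and r is odd, sliding by one helps when g' > g.
-- When g' = g, every corner has s and t of different parity. The four given points are lattice
-- points, so each of them then lies on the line of a side at least one unit beyond a corner: this
-- is where the four extra vertices of H₃ᵏ come from. All these positions are settled by linear
-- inequalities over ℤ in which parity counts, hence the decision procedure.

module LinearArithmetic where

  private variable n : ℕ

  infixl 6 _⊕_ _⊖_
  infix 4 _≼_ _≈_
  infixl 6 _+ᴸ_
  infixr 7 _*ᴸ_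
  infixr 3 _∧′_
  infixr 2 _∨′_
  infixr 1 _⇒_

  data Expr (n : ℕ) : Set where
    var     : Fin n → Expr n
    con     : ℤ → Expr n
    _⊕_ _⊖_ : Expr n → Expr n → Expr n

  data Form (n : ℕ) : Set where
    _≼_ _≈_        : Expr n → Expr n → Form n
    _∧′_ _∨′_ _⇒_  : Form n → Form n → Form n

  ⟦_⟧ₑ : Expr n → Vec ℤ n → ℤ
  ⟦ var i ⟧ₑ ρ = V.lookup ρ i
  ⟦ con c ⟧ₑ ρ = c
  ⟦ e ⊕ f ⟧ₑ ρ = ⟦ e ⟧ₑ ρ ℤ.+ ⟦ f ⟧ₑ ρ
  ⟦ e ⊖ f ⟧ₑ ρ = ⟦ e ⟧ₑ ρ ℤ.- ⟦ f ⟧ₑ ρ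

  ⟦_⟧ : Form n → Vec ℤ n → Set
  ⟦ e ≼ f ⟧ ρ = ⟦ e ⟧ₑ ρ ℤ.≤ ⟦ f ⟧ₑ ρ
  ⟦ e ≈ f ⟧ ρ = ⟦ e ⟧ₑ ρ ≡ ⟦ f ⟧ₑ ρ
  ⟦ F ∧′ G ⟧ ρ = ⟦ F ⟧ ρ × ⟦ G ⟧ ρ
  ⟦ F ∨′ G ⟧ ρ = ⟦ F ⟧ ρ ⊎ ⟦ G ⟧ ρ
  ⟦ F ⇒ G ⟧ ρ = ⟦ F ⟧ ρ → ⟦ G ⟧ ρ

  ⟦_⟧? : (F : Form n) (ρ : Vec ℤ n) → Dec (⟦ F ⟧ ρ)
  ⟦ e ≼ f ⟧? ρ = ⟦ e ⟧ₑ ρ ℤ.≤? ⟦ f ⟧ₑ ρ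
  ⟦ e ≈ f ⟧? ρ = ⟦ e ⟧ₑ ρ ℤ.≟ ⟦ f ⟧ₑ ρ
  ⟦ F ∧′ G ⟧? ρ = ⟦ F ⟧? ρ ×-dec ⟦ G ⟧? ρ
  ⟦ F ∨′ G ⟧? ρ = ⟦ F ⟧? ρ ⊎-dec ⟦ G ⟧? ρ
  ⟦ F ⇒ G ⟧? ρ = ⟦ F ⟧? ρ →-dec ⟦ G ⟧? ρ

  -- (c , as) stands for c + Σ asᵢ ρᵢ.
  Lin : ℕ → Set
  Lin n = ℤ × Vec ℤ n

  dot : Vec ℤ n → Vec ℤ n → ℤ
  dot []       []       = + 0
  dot (a ∷ as) (x ∷ ρ) = a ℤ.* x ℤ.+ dot as ρ

  val : Vec ℤ n → Lin n → ℤ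
  val ρ (c , as) = c ℤ.+ dot as ρ

  _+ᴸ_ : Lin n → Lin n → Lin n
  (c , as) +ᴸ (b , bs) = c ℤ.+ b , V.zipWith ℤ._+_ as bs

  _*ᴸ_ : ℤ → Lin n → Lin n
  k *ᴸ (c , as) = k ℤ.* c , V.map (k ℤ.*_) as

  unit : Fin n → Vec ℤ n
  unit zero    = + 1 ∷ V.replicate _ (+ 0)
  unit (suc i) = + 0 ∷ unit i

  dot-+ : (as bs ρ : Vec ℤ n) → dot (V.zipWith ℤ._+_ as bs) ρ ≡ dot as ρ ℤ.+ dot bs ρ
  dot-+ []       []       []      = refl
  dot-+ (a ∷ as) (b ∷ bs) (x ∷ ρ) rewrite dot-+ as bs ρ = lemma a b x (dot as ρ) (dot bs ρ)
    where
    lemma : ∀ a b x s t → (a ℤ.+ b) ℤ.* x ℤ.+ (s ℤ.+ t) ≡ a ℤ.* x ℤ.+ s ℤ.+ (b ℤ.* x ℤ.+ t)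
    lemma = solve-∀

  dot-* : (k : ℤ) (as ρ : Vec ℤ n) → dot (V.map (k ℤ.*_) as) ρ ≡ k ℤ.* dot as ρ
  dot-* k []       []      = sym (ℤₚ.*-zeroʳ k)
  dot-* k (a ∷ as) (x ∷ ρ) rewrite dot-* k as ρ = lemma k a x (dot as ρ)
    where
    lemma : ∀ k a x s → k ℤ.* a ℤ.* x ℤ.+ k ℤ.* s ≡ k ℤ.* (a ℤ.* x ℤ.+ s)
    lemma = solve-∀

  dot-0 : (ρ : Vec ℤ n) → dot (V.replicate _ (+ 0)) ρ ≡ + 0
  dot-0 []      = refl
  dot-0 (x ∷ ρ) rewrite dot-0 ρ = refl

  dot-unit : (i : Fin n) (ρ : Vec ℤ n) → dot (unit i) ρ ≡ V.lookup ρ i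
  dot-unit zero    (x ∷ ρ) rewrite dot-0 ρ = trans (ℤₚ.+-identityʳ _) (ℤₚ.*-identityˡ x)
  dot-unit (suc i) (x ∷ ρ) rewrite dot-unit i ρ = ℤₚ.+-identityˡ _

  val-+ : (ρ : Vec ℤ n) (l m : Lin n) → val ρ (l +ᴸ m) ≡ val ρ l ℤ.+ val ρ m
  val-+ ρ (c , as) (b , bs) rewrite dot-+ as bs ρ = lemma c b (dot as ρ) (dot bs ρ)
    where
    lemma : ∀ a b s t → a ℤ.+ b ℤ.+ (s ℤ.+ t) ≡ a ℤ.+ s ℤ.+ (b ℤ.+ t)
    lemma = solve-∀

  val-* : (ρ : Vec ℤ n) (k : ℤ) (l : Lin n) → val ρ (k *ᴸ l) ≡ k ℤ.* val ρ l
  val-* ρ k (c , as) rewrite dot-* k as ρ = sym (ℤₚ.*-distribˡ-+ k c (dot as ρ))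

  lin : Expr n → Lin n
  lin (var i) = + 0 , unit i
  lin (con c) = c , V.replicate _ (+ 0)
  lin (e ⊕ f) = lin e +ᴸ lin f
  lin (e ⊖ f) = lin e +ᴸ (-[1+ 0 ] *ᴸ lin f)

  lin-correct : (ρ : Vec ℤ n) (e : Expr n) → val ρ (lin e) ≡ ⟦ e ⟧ₑ ρ
  lin-correct ρ (var i) = trans (ℤₚ.+-identityˡ _) (dot-unit i ρ)
  lin-correct ρ (con c) rewrite dot-0 ρ = ℤₚ.+-identityʳ c
  lin-correct ρ (e ⊕ f) rewrite val-+ ρ (lin e) (lin f) | lin-correct ρ e | lin-correct ρ f = refl
  lin-correct ρ (e ⊖ f)
    rewrite val-+ ρ (lin e) (-[1+ 0 ] *ᴸ lin f) | val-* ρ -[1+ 0 ] (lin f)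
          | lin-correct ρ e | lin-correct ρ f = cong (λ t → ⟦ e ⟧ₑ ρ ℤ.+ t) (ℤₚ.-1*i≡-i _)

  data Lit (n : ℕ) : Set where
    nonneg null : Lin n → Lit n

  Holds : Vec ℤ n → Lit n → Set
  Holds ρ (nonneg l) = + 0 ℤ.≤ val ρ l
  Holds ρ (null l)   = val ρ l ≡ + 0

  DNF : ℕ → Set
  DNF n = List (List (Lit n))

  Sat : Vec ℤ n → DNF n → Set
  Sat ρ = Any (All (Holds ρ))

  _⊗_ : DNF n → DNF n → DNF n
  []       ⊗ Q = []
  (c ∷ P) ⊗ Q = L.map (c ++_) Q ++ (P ⊗ Q)

  ⊗-sat : ∀ (ρ : Vec ℤ n) P {Q} → Sat ρ P → Sat ρ Q → Sat ρ (P ⊗ Q)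
  ⊗-sat ρ (c ∷ P) (here p)  q = Anyₚ.++⁺ˡ (Anyₚ.map⁺ (Any.map (Allₚ.++⁺ p) q))
  ⊗-sat ρ (c ∷ P) (there p) q = Anyₚ.++⁺ʳ _ (⊗-sat ρ P p q)

  -- Negations are pushed down to the atoms. Over ℤ a failed `≼` is a strict inequality, hence a
  -- weak one after a shift by one, and a failed `≈` is a choice between two of these.
  affirm deny : Form n → DNF n
  affirm (e ≼ f)  = (nonneg (lin (f ⊖ e)) ∷ []) ∷ []
  affirm (e ≈ f)  = (null (lin (e ⊖ f)) ∷ []) ∷ []
  affirm (F ∧′ G) = affirm F ⊗ affirm G
  affirm (F ∨′ G) = affirm F ++ affirm G
  affirm (F ⇒ G)  = deny F ++ affirm G
  deny (e ≼ f)  = (nonneg (lin (e ⊖ f ⊖ con (+ 1))) ∷ []) ∷ []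
  deny (e ≈ f)  = (nonneg (lin (e ⊖ f ⊖ con (+ 1))) ∷ []) ∷ (nonneg (lin (f ⊖ e ⊖ con (+ 1))) ∷ []) ∷ []
  deny (F ∧′ G) = deny F ++ deny G
  deny (F ∨′ G) = deny F ⊗ deny G
  deny (F ⇒ G)  = affirm F ⊗ deny G

  holds-≤ : (ρ : Vec ℤ n) (e f : Expr n) → ⟦ e ⟧ₑ ρ ℤ.≤ ⟦ f ⟧ₑ ρ → Holds ρ (nonneg (lin (f ⊖ e)))
  holds-≤ ρ e f p rewrite lin-correct ρ (f ⊖ e) = ℤₚ.i≤j⇒0≤j-i p

  holds-< : (ρ : Vec ℤ n) (e f : Expr n) → ⟦ f ⟧ₑ ρ ℤ.< ⟦ e ⟧ₑ ρ →
            Holds ρ (nonneg (lin (e ⊖ f ⊖ con (+ 1))))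
  holds-< ρ e f p rewrite lin-correct ρ (e ⊖ f ⊖ con (+ 1)) =
    subst (+ 0 ℤ.≤_) (lemma (⟦ e ⟧ₑ ρ) (⟦ f ⟧ₑ ρ)) (ℤₚ.i≤j⇒0≤j-i (ℤₚ.i<j⇒suc[i]≤j p))
    where
    lemma : ∀ x y → x ℤ.- (+ 1 ℤ.+ y) ≡ x ℤ.- y ℤ.- + 1
    lemma = solve-∀

  affirm-sat : (ρ : Vec ℤ n) (F : Form n) → ⟦ F ⟧ ρ → Sat ρ (affirm F)
  deny-sat : (ρ : Vec ℤ n) (F : Form n) → ¬ ⟦ F ⟧ ρ → Sat ρ (deny F)
  affirm-sat ρ (e ≼ f) p = here (holds-≤ ρ e f p ∷ [])
  affirm-sat ρ (e ≈ f) p = here (trans (lin-correct ρ (e ⊖ f)) (ℤₚ.i≡j⇒i-j≡0 p) ∷ [])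
  affirm-sat ρ (F ∧′ G) (p , q) = ⊗-sat ρ (affirm F) (affirm-sat ρ F p) (affirm-sat ρ G q)
  affirm-sat ρ (F ∨′ G) (inj₁ p) = Anyₚ.++⁺ˡ (affirm-sat ρ F p)
  affirm-sat ρ (F ∨′ G) (inj₂ q) = Anyₚ.++⁺ʳ (affirm F) (affirm-sat ρ G q)
  affirm-sat ρ (F ⇒ G) p with ⟦ F ⟧? ρ
  ... | yes q = Anyₚ.++⁺ʳ (deny F) (affirm-sat ρ G (p q))
  ... | no ¬q = Anyₚ.++⁺ˡ (deny-sat ρ F ¬q)
  deny-sat ρ (e ≼ f) p = here (holds-< ρ e f (ℤₚ.≰⇒> p) ∷ [])
  deny-sat ρ (e ≈ f) p with ⟦ e ⟧ₑ ρ ℤ.≤? ⟦ f ⟧ₑ ρ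
  ... | yes q = there (here (holds-< ρ f e (ℤₚ.≤∧≢⇒< q p) ∷ []))
  ... | no ¬q = here (holds-< ρ e f (ℤₚ.≰⇒> ¬q) ∷ [])
  deny-sat ρ (F ∧′ G) p with ⟦ F ⟧? ρ
  ... | yes q = Anyₚ.++⁺ʳ (deny F) (deny-sat ρ G (λ r → p (q , r)))
  ... | no ¬q = Anyₚ.++⁺ˡ (deny-sat ρ F ¬q)
  deny-sat ρ (F ∨′ G) p = ⊗-sat ρ (deny F) (deny-sat ρ F (p ∘ inj₁)) (deny-sat ρ G (p ∘ inj₂))
  deny-sat ρ (F ⇒ G) p with ⟦ F ⟧? ρ
  ... | yes q = ⊗-sat ρ (affirm F) (affirm-sat ρ F q) (deny-sat ρ G (λ r → p (λ _ → r)))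
  ... | no ¬q = ⊥-elim (p (⊥-elim ∘ ¬q))

  -- A bound on the number of steps replaces a termination argument: the result
  -- is only used through a test of divisibility.
  gcd : ℕ → ℕ → ℕ → ℕ
  gcd zero    a b       = a
  gcd (suc t) a zero    = a
  gcd (suc t) a (suc b) = gcd t (suc b) (a ℕ.% suc b)

  content : Vec ℤ n → ℕ
  content = V.foldr _ (λ a g → gcd 100 g ∣ a ∣) 0

  -- Dividing by the content and rounding the constant down is what makes the
  -- procedure see parities.
  tighten : Lin n → Lin n
  tighten (c , as) with content as
  ... | zero  = c , as
  ... | suc g with Vₚ.≡-dec ℤ._≟_ as (V.map (+ suc g ℤ.*_) (V.map (_/ℕ suc g) as))
  ...   | yes _ = c /ℕ suc g , V.map (_/ℕ suc g) as
  ...   | no _  = c , as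

  -- Divide c by n = `suc g` with quotient q and remainder r < n. If q + y were at most -1, then c +
  -- n y would be at most r - n, which is negative.
  floor-nonneg : ∀ g c y → + 0 ℤ.≤ c ℤ.+ + suc g ℤ.* y → + 0 ℤ.≤ c /ℕ suc g ℤ.+ y
  floor-nonneg g c y p with + 0 ℤ.≤? c /ℕ suc g ℤ.+ y
  ... | yes q = q
  ... | no ¬q = ⊥-elim (ℤₚ.<-irrefl refl (ℤₚ.≤-<-trans p neg))
    where
    r = c %ℕ suc g
    q = c /ℕ suc g
    open ℤₚ.≤-Reasoning
    lemma : ∀ r q g y → r ℤ.+ q ℤ.* g ℤ.+ g ℤ.* y ≡ r ℤ.+ g ℤ.* (q ℤ.+ y)
    lemma = solve-∀
    neg : c ℤ.+ + suc g ℤ.* y ℤ.< + 0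
    neg = begin-strict
      c ℤ.+ + suc g ℤ.* y                    ≡⟨ cong (λ z → z ℤ.+ + suc g ℤ.* y) (a≡a%ℕn+[a/ℕn]*n c (suc g)) ⟩
      + r ℤ.+ q ℤ.* + suc g ℤ.+ + suc g ℤ.* y ≡⟨ lemma (+ r) q (+ suc g) y ⟩
      + r ℤ.+ + suc g ℤ.* (q ℤ.+ y)          ≤⟨ ℤₚ.+-monoʳ-≤ (+ r) (ℤₚ.*-monoˡ-≤-nonNeg (+ suc g) (ℤₚ.i<j⇒i≤pred[j] (ℤₚ.≰⇒> ¬q))) ⟩
      + r ℤ.+ + suc g ℤ.* -[1+ 0 ]           <⟨ ℤₚ.+-monoˡ-< (+ suc g ℤ.* -[1+ 0 ]) (ℤ.+<+ (n%ℕd<d c (suc g))) ⟩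
      + suc g ℤ.+ + suc g ℤ.* -[1+ 0 ]       ≡⟨ cong (ℤ._+_ (+ suc g)) (trans (ℤₚ.*-comm (+ suc g) -[1+ 0 ]) (ℤₚ.-1*i≡-i (+ suc g))) ⟩
      + suc g ℤ.- + suc g                    ≡⟨ ℤₚ.+-inverseʳ (+ suc g) ⟩
      + 0 ∎

  tighten-nonneg : (ρ : Vec ℤ n) (l : Lin n) → + 0 ℤ.≤ val ρ l → + 0 ℤ.≤ val ρ (tighten l)
  tighten-nonneg ρ (c , as) p with content as
  ... | zero  = p
  ... | suc g with Vₚ.≡-dec ℤ._≟_ as (V.map (+ suc g ℤ.*_) (V.map (_/ℕ suc g) as))
  ...   | no _  = p
  ...   | yes q = floor-nonneg g c _ (subst (λ t → + 0 ℤ.≤ c ℤ.+ t)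
                    (trans (cong (λ bs → dot bs ρ) q) (dot-* (+ suc g) (V.map (_/ℕ suc g) as) ρ)) p)

  private
    isPos isNeg isUnit isZero : ℤ → Bool
    isPos (+ suc _) = true
    isPos _         = false
    isNeg -[1+ _ ] = true
    isNeg _        = false
    isUnit (+ 1)    = true
    isUnit -[1+ 0 ] = true
    isUnit _        = false
    isZero (+ 0) = true
    isZero _     = false

    eqᵇ : ℤ → ℤ → Bool
    eqᵇ x y = isZero (x ℤ.- y)

    eqVᵇ : Vec ℤ n → Vec ℤ n → Bool
    eqVᵇ []       []       = true
    eqVᵇ (a ∷ as) (b ∷ bs) = if eqᵇ a b then eqVᵇ as bs else false

  Pos : Vec ℤ n → Lin n → Set
  Pos ρ l = + 0 ℤ.≤ val ρ l

  -- Of two inequalities with equal coefficients the one with the smaller constant implies the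
  -- other; keeping only that one limits the growth of the system.
  insert : Lin n → List (Lin n) → List (Lin n)
  insert l [] = l ∷ []
  insert l (m ∷ ms) =
    if eqVᵇ (proj₂ l) (proj₂ m)
    then (if isNeg (proj₁ m ℤ.- proj₁ l) then m ∷ ms else l ∷ ms)
    else m ∷ insert l ms

  insert-pos : (ρ : Vec ℤ n) {l : Lin n} {ms : List (Lin n)} →
               Pos ρ l → All (Pos ρ) ms → All (Pos ρ) (insert l ms)
  insert-pos ρ p [] = p ∷ []
  insert-pos ρ {l} {m ∷ ms} p (q ∷ qs) with eqVᵇ (proj₂ l) (proj₂ m)
  ... | false = q ∷ insert-pos ρ p qs
  ... | true with isNeg (proj₁ m ℤ.- proj₁ l)
  ...   | true  = q ∷ qs
  ...   | false = p ∷ qs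

  constant : Lin n → Bool
  constant (_ , as) = V.foldr _ (λ a b → if isZero a then b else false) true as

  simplify : List (Lin n) → List (Lin n)
  simplify [] = []
  simplify (l ∷ ls) = if constant l then (if isNeg (proj₁ l) then l ∷ [] else simplify ls)
                      else insert (tighten l) (simplify ls)

  simplify-pos : (ρ : Vec ℤ n) {ls : List (Lin n)} → All (Pos ρ) ls → All (Pos ρ) (simplify ls)
  simplify-pos ρ [] = []
  simplify-pos ρ {l ∷ ls} (p ∷ ps) with constant l
  ... | false = insert-pos ρ (tighten-nonneg ρ l p) (simplify-pos ρ ps)
  ... | true with isNeg (proj₁ l)
  ...   | true  = p ∷ []
  ...   | false = simplify-pos ρ ps

  absurd : Lin n → Bool
  absurd l with Vₚ.≡-dec ℤ._≟_ (proj₂ l) (V.replicate _ (+ 0))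
  ... | yes _ = isNeg (proj₁ l)
  ... | no _  = false

  absurd-sound : (ρ : Vec ℤ n) (l : Lin n) → absurd l ≡ true → ¬ Pos ρ l
  absurd-sound ρ (c , as) t p with Vₚ.≡-dec ℤ._≟_ as (V.replicate _ (+ 0))
  absurd-sound ρ (-[1+ c ] , _) t p | yes refl with subst (λ s → + 0 ℤ.≤ -[1+ c ] ℤ.+ s) (dot-0 ρ) p
  ... | ()

  private
    count : (ℤ → Bool) → Fin n → List (Lin n) → ℕ
    count f i []       = 0
    count f i (l ∷ ls) = if f (V.lookup (proj₂ l) i) then suc (count f i ls) else count f i ls

    isBig : ℤ → Bool
    isBig (+ suc (suc _))  = true
    isBig -[1+ suc _ ] = true
    isBig _            = false

    -- Elimination is exact over ℤ when the coefficients on one side are units, so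
    -- such variables go first.
    cost : Fin n → List (Lin n) → ℕ
    cost i ls = count isPos i ls ℕ.* count isNeg i ls ℕ.+
                1000 ℕ.* (count (λ a → if isPos a then isBig a else false) i ls ℕ.*
                          count (λ a → if isNeg a then isBig a else false) i ls)

    best : List (Lin n) → List (Fin n) → Maybe (ℕ × Fin n)
    best ls []       = nothing
    best ls (i ∷ is) with count isPos i ls ℕ.+ count isNeg i ls | cost i ls | best ls is
    ... | zero  | _ | r            = r
    ... | suc _ | m | nothing      = just (m , i)
    ... | suc _ | m | just (c , j) = if m ℕ.<ᵇ c then just (m , i) else just (c , j)

  -- When the two coefficients of variable i have opposite signs, this sum cancels it. The
  -- multipliers are absolute values, so the sum stays nonnegative.
  combine : Fin n → Lin n → Lin n → Lin n
  combine i l m = (+ ∣ V.lookup (proj₂ m) i ∣ *ᴸ l) +ᴸ (+ ∣ V.lookup (proj₂ l) i ∣ *ᴸ m)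

  combine-pos : (ρ : Vec ℤ n) (i : Fin n) (l m : Lin n) → Pos ρ l → Pos ρ m → Pos ρ (combine i l m)
  combine-pos ρ i l m p q
    rewrite val-+ ρ (+ ∣ V.lookup (proj₂ m) i ∣ *ᴸ l) (+ ∣ V.lookup (proj₂ l) i ∣ *ᴸ m)
          | val-* ρ (+ ∣ V.lookup (proj₂ m) i ∣) l | val-* ρ (+ ∣ V.lookup (proj₂ l) i ∣) m
    = ℤₚ.+-mono-≤ (scaled (∣ V.lookup (proj₂ m) i ∣) p) (scaled (∣ V.lookup (proj₂ l) i ∣) q)
    where
    scaled : ∀ k {x} → + 0 ℤ.≤ x → + 0 ℤ.≤ + k ℤ.* x
    scaled k {x} h = subst (ℤ._≤ + k ℤ.* x) (ℤₚ.*-zeroʳ (+ k)) (ℤₚ.*-monoˡ-≤-nonNeg (+ k) h)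

  select : (ℤ → Bool) → Fin n → List (Lin n) → List (Lin n)
  select f i []       = []
  select f i (l ∷ ls) = if f (V.lookup (proj₂ l) i) then l ∷ select f i ls else select f i ls

  select-pos : (ρ : Vec ℤ n) (f : ℤ → Bool) (i : Fin n) {ls : List (Lin n)} →
               All (Pos ρ) ls → All (Pos ρ) (select f i ls)
  select-pos ρ f i [] = []
  select-pos ρ f i {l ∷ ls} (p ∷ ps) with f (V.lookup (proj₂ l) i)
  ... | true  = p ∷ select-pos ρ f i ps
  ... | false = select-pos ρ f i ps

  combineAll : Fin n → List (Lin n) → List (Lin n) → List (Lin n)
  combineAll i []       ms = []
  combineAll i (l ∷ ls) ms = L.map (combine i l) ms ++ combineAll i ls ms

  combineAll-pos : (ρ : Vec ℤ n) (i : Fin n) {ls ms : List (Lin n)} →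
                   All (Pos ρ) ls → All (Pos ρ) ms → All (Pos ρ) (combineAll i ls ms)
  combineAll-pos ρ i []       qs = []
  combineAll-pos ρ i {l ∷ _} (p ∷ ps) qs =
    Allₚ.++⁺ (Allₚ.map⁺ (All.map (λ {m} → combine-pos ρ i l m p) qs)) (combineAll-pos ρ i ps qs)

  eliminate : Fin n → List (Lin n) → List (Lin n)
  eliminate i ls = select isZero i ls ++ combineAll i (select isPos i ls) (select isNeg i ls)

  fourierMotzkin : ℕ → List (Lin n) → Bool
  fourierMotzkin zero    ls = any absurd ls
  fourierMotzkin (suc t) ls with best ls (L.allFin _)
  ... | nothing      = any absurd ls
  ... | just (_ , i) = fourierMotzkin t (simplify (eliminate i ls))

  any-absurd : (ρ : Vec ℤ n) (ls : List (Lin n)) → any absurd ls ≡ true → ¬ All (Pos ρ) ls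
  any-absurd ρ (l ∷ ls) t (p ∷ ps) with absurd l in eq
  ... | true  = absurd-sound ρ l eq p
  ... | false = any-absurd ρ ls t ps

  fourierMotzkin-sound : (ρ : Vec ℤ n) (t : ℕ) (ls : List (Lin n)) →
                         fourierMotzkin t ls ≡ true → ¬ All (Pos ρ) ls
  fourierMotzkin-sound ρ zero    ls h ps = any-absurd ρ ls h ps
  fourierMotzkin-sound ρ (suc t) ls h ps with best ls (L.allFin _)
  ... | nothing      = any-absurd ρ ls h ps
  ... | just (_ , i) = fourierMotzkin-sound ρ t _ h (simplify-pos ρ (Allₚ.++⁺ (select-pos ρ isZero i ps)
                         (combineAll-pos ρ i (select-pos ρ isPos i ps) (select-pos ρ isNeg i ps))))

  private
    unitIndex : Vec ℤ n → Maybe (Fin n)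
    unitIndex [] = nothing
    unitIndex (a ∷ as) = if isUnit a then just zero else Maybe.map suc (unitIndex as)

  -- The coefficient of i in e is 1 or -1, hence its own inverse, so subtracting this multiple of e
  -- clears variable i in l.
  substitute : Fin n → Lin n → Lin n → Lin n
  substitute i e l = l +ᴸ ((ℤ.- (V.lookup (proj₂ l) i ℤ.* V.lookup (proj₂ e) i)) *ᴸ e)

  substitute-val : (ρ : Vec ℤ n) (i : Fin n) (e l : Lin n) → val ρ e ≡ + 0 →
                   val ρ (substitute i e l) ≡ val ρ l
  substitute-val ρ i e l p = begin
    val ρ (l +ᴸ (k *ᴸ e))        ≡⟨ val-+ ρ l (k *ᴸ e) ⟩
    val ρ l ℤ.+ val ρ (k *ᴸ e)   ≡⟨ cong (λ z → val ρ l ℤ.+ z) (val-* ρ k e) ⟩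
    val ρ l ℤ.+ k ℤ.* val ρ e    ≡⟨ cong (λ z → val ρ l ℤ.+ k ℤ.* z) p ⟩
    val ρ l ℤ.+ k ℤ.* + 0        ≡⟨ cong (λ z → val ρ l ℤ.+ z) (ℤₚ.*-zeroʳ k) ⟩
    val ρ l ℤ.+ + 0              ≡⟨ ℤₚ.+-identityʳ _ ⟩
    val ρ l ∎
    where
    open ≡-Reasoning
    k = ℤ.- (V.lookup (proj₂ l) i ℤ.* V.lookup (proj₂ e) i)

  gauss : ℕ → List (Lin n) → List (Lin n) → List (Lin n)
  gauss zero    es       ls = ls
  gauss (suc t) []       ls = ls
  gauss (suc t) (e ∷ es) ls with unitIndex (proj₂ e)
  ... | just i  = gauss t (L.map (substitute i e) es) (L.map (substitute i e) ls)
  -- Without a unit coefficient the equation cannot be solved for a variable over ℤ; it is kept as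
  -- two opposite inequalities.
  ... | nothing = gauss t es (e ∷ (-[1+ 0 ] *ᴸ e) ∷ ls)

  gauss-pos : (ρ : Vec ℤ n) (t : ℕ) {es ls : List (Lin n)} →
              All (λ e → val ρ e ≡ + 0) es → All (Pos ρ) ls → All (Pos ρ) (gauss t es ls)
  gauss-pos ρ zero    hs       ps = ps
  gauss-pos ρ (suc t) []       ps = ps
  gauss-pos ρ (suc t) {e ∷ es} (h ∷ hs) ps with unitIndex (proj₂ e)
  ... | just i  = gauss-pos ρ t
                    (Allₚ.map⁺ (All.map (λ {l} q → trans (substitute-val ρ i e l h) q) hs))
                    (Allₚ.map⁺ (All.map (λ {l} → subst (+ 0 ℤ.≤_) (sym (substitute-val ρ i e l h))) ps))
  ... | nothing = gauss-pos ρ t hs (ℤₚ.≤-reflexive (sym h) ∷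
                    ℤₚ.≤-reflexive (sym (trans (val-* ρ -[1+ 0 ] e) (cong (-[1+ 0 ] ℤ.*_) h))) ∷ ps)

  equalities inequalities : List (Lit n) → List (Lin n)
  equalities []              = []
  equalities (nonneg l ∷ ls) = equalities ls
  equalities (null l ∷ ls)   = l ∷ equalities ls
  inequalities []              = []
  inequalities (nonneg l ∷ ls) = l ∷ inequalities ls
  inequalities (null l ∷ ls)   = inequalities ls

  split-holds : (ρ : Vec ℤ n) {ls : List (Lit n)} → All (Holds ρ) ls →
                All (λ e → val ρ e ≡ + 0) (equalities ls) × All (Pos ρ) (inequalities ls)
  split-holds ρ [] = [] , []
  split-holds ρ {nonneg l ∷ ls} (p ∷ ps) = proj₁ (split-holds ρ ps) , p ∷ proj₂ (split-holds ρ ps)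
  split-holds ρ {null l ∷ ls}   (p ∷ ps) = p ∷ proj₁ (split-holds ρ ps) , proj₂ (split-holds ρ ps)

  refute : List (Lit n) → Bool
  -- Each round clears one variable, so the bound `suc n` is never the reason to stop.
  refute {n} ls = fourierMotzkin (suc n) (simplify (gauss (L.length ls) (equalities ls) (inequalities ls)))

  refute-sound : (ρ : Vec ℤ n) (ls : List (Lit n)) → refute ls ≡ true → ¬ All (Holds ρ) ls
  refute-sound {n} ρ ls h ps =
    fourierMotzkin-sound ρ (suc n) _ h (simplify-pos ρ (gauss-pos ρ (L.length ls) (proj₁ q) (proj₂ q)))
    where q = split-holds ρ ps

  valid : Form n → Bool
  valid F = all refute (deny F)

  all-refute : (ρ : Vec ℤ n) (D : DNF n) → all refute D ≡ true → ¬ Sat ρ D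
  all-refute ρ (c ∷ D) h s with refute c in eq
  all-refute ρ (c ∷ D) h (here p)  | true = refute-sound ρ c eq p
  all-refute ρ (c ∷ D) h (there p) | true = all-refute ρ D h p

  valid-sound : (F : Form n) → valid F ≡ true → (ρ : Vec ℤ n) → ⟦ F ⟧ ρ
  valid-sound F h ρ = decidable-stable (⟦ F ⟧? ρ) λ ¬F → all-refute ρ (deny F) h (deny-sat ρ F ¬F)

  vars : Vec (Expr n) n
  vars = V.tabulate var

  ∀-intro : ∀ n {P : Vec ℤ n → Set} → (∀ ρ → P ρ) → ∀ⁿ n (curryⁿ P)
  ∀-intro zero    h = h []
  ∀-intro (suc n) h = λ x → ∀-intro n (λ ρ → h (x ∷ ρ))

  -- The formula is given as a function of its variables. Both its syntax and its meaning are then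
  -- obtained by computation, so every use needs only `refl` as its certificate.
  lia : (n : ℕ) (f : N-ary n (Expr n) (Form n)) → valid (f $ⁿ vars) ≡ true →
        ∀ⁿ n (curryⁿ ⟦ f $ⁿ vars ⟧)
  lia n f h = ∀-intro n (valid-sound (f $ⁿ vars) h)

open LinearArithmetic

-- Distances in graphs

module DistProperties {V : Set} (vs : List V) (adj eq : V → V → Bool)
                      (eq-refl : ∀ u → T (eq u u)) (eq-sound : ∀ u v → T (eq u v) → u ≡ v) where

  open Dist vs adj eq

  least-≤ : ∀ f b i → T (f i) → least f b ≤ i
  least-≤ f zero    i p = z≤n
  least-≤ f (suc b) i p with f zero in eq
  ... | true = z≤n
  least-≤ f (suc b) zero    p | false rewrite eq = contradiction p (λ ())
  least-≤ f (suc b) (suc i) p | false = s≤s (least-≤ (f ∘ suc) b i p)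

  least-true : ∀ f b → least f b < b → T (f (least f b))
  least-true f (suc b) p with f zero in eq
  ... | true rewrite eq = tt
  ... | false = least-true (f ∘ suc) b (ℕ.s<s⁻¹ p)

  -- `T (ball k u v)` unfolds as soon as k is a constructor, after which k, u and v cannot be
  -- inferred from it; the record keeps them visible.
  record Ball (k : ℕ) (u v : V) : Set where
    constructor ⟨_⟩
    field holds : T (ball k u v)
  open Ball

  ball-refl : ∀ u → Ball 0 u u
  ball-refl u = ⟨ eq-refl u ⟩

  ball-zero : ∀ {u v} → Ball 0 u v → u ≡ v
  ball-zero ⟨ p ⟩ = eq-sound _ _ p

  ball-suc : ∀ {k u v} → Ball k u v → Ball (suc k) u v
  ball-suc ⟨ p ⟩ = ⟨ Equivalence.from T-∨ (inj₁ p) ⟩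

  ball-step : ∀ {k u w v} → w ∈ vs → Ball k u w → T (adj w v) → Ball (suc k) u v
  ball-step {k} {u} {w} {v} w∈ ⟨ p ⟩ a = ⟨ Equivalence.from (T-∨ {ball k u v})
    (inj₂ (Anyₚ.any⁺ _ (lose w∈ (Equivalence.from T-∧ (p , a))))) ⟩

  ball-suc⁻ : ∀ {k u v} → Ball (suc k) u v →
              Ball k u v ⊎ (∃ λ w → w ∈ vs × Ball k u w × T (adj w v))
  ball-suc⁻ {k} {u} {v} ⟨ p ⟩ with Equivalence.to (T-∨ {ball k u v}) p
  ... | inj₁ q = inj₁ ⟨ q ⟩
  ... | inj₂ q with find (Anyₚ.any⁻ _ vs q)
  ...   | w , w∈ , r with Equivalence.to T-∧ r
  ...     | s , a = inj₂ (w , w∈ , ⟨ s ⟩ , a)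

  ball-mono : ∀ {j k u v} → j ≤ k → Ball j u v → Ball k u v
  ball-mono {j} {k} {u} {v} j≤k p = go (ℕₚ.≤⇒≤′ j≤k)
    where
    go : ∀ {k} → j ℕ.≤′ k → Ball k u v
    go ℕ.≤′-refl     = p
    go (ℕ.≤′-step q) = ball-suc (go q)

  ball-trans : ∀ {i j u v w} → Ball i u v → Ball j v w → Ball (i ℕ.+ j) u w
  ball-trans {i} {zero} {u} {v} {w} p q rewrite ℕₚ.+-identityʳ i | ball-zero q = p
  ball-trans {i} {suc j} p q rewrite ℕₚ.+-suc i j with ball-suc⁻ {j} q
  ... | inj₁ r = ball-suc (ball-trans p r)
  ... | inj₂ (w′ , w′∈ , r , a) = ball-step w′∈ (ball-trans {i} {j} p r) a

  ball-split : ∀ i j {u v} → Ball (i ℕ.+ j) u v → ∃ λ w → Ball i u w × Ball j w v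
  ball-split i zero {u} {v} p rewrite ℕₚ.+-identityʳ i = v , p , ball-refl v
  ball-split i (suc j) p rewrite ℕₚ.+-suc i j with ball-suc⁻ {i ℕ.+ j} p
  ... | inj₁ q with ball-split i j q
  ...   | w , r , s = w , r , ball-suc s
  ball-split i (suc j) p | inj₂ (w′ , w′∈ , q , a) with ball-split i j q
  ...   | w , r , s = w , r , ball-step w′∈ s a

  ball-sym : (∀ u v → T (adj u v) → T (adj v u)) →
             ∀ k {u v} → v ∈ vs → Ball k u v → Ball k v u
  ball-sym adj-sym zero {u} {v} v∈ p rewrite ball-zero p = ball-refl v
  ball-sym adj-sym (suc k) {u} {v} v∈ p with ball-suc⁻ {k} p
  ... | inj₁ q = ball-suc (ball-sym adj-sym k v∈ q)
  ... | inj₂ (w , w∈ , q , a) =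
    ball-trans {1} {k} (ball-step v∈ (ball-refl v) (adj-sym w v a)) (ball-sym adj-sym k w∈ q)

  Exact : ℕ → V → V → Set
  Exact k u v = Ball k u v × (∀ j → Ball j u v → k ≤ j)

  exact : ∀ {k u v} → Ball k u v → ∃ λ m → Exact m u v
  exact {k} {u} {v} p = least f (suc k) , ⟨ least-true f (suc k) (s≤s (least-≤ f (suc k) k (holds p))) ⟩ ,
    λ j q → least-≤ f (suc k) j (holds q)
    where f = λ i → ball i u v

  exact-pred : ∀ {k u v} → Exact (suc k) u v → ∃ λ w → w ∈ vs × Exact k u w
  exact-pred {k} {u} {v} (p , min) with ball-suc⁻ {k} p
  ... | inj₁ q = contradiction (min k q) ℕₚ.1+n≰n
  ... | inj₂ (w , w∈ , q , a) =
    w , w∈ , q , λ j r → ℕ.s≤s⁻¹ (min (suc j) (ball-step w∈ r a))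

  exact-below : ∀ {m u v} → v ∈ vs → Exact m u v → ∀ i → i ≤ m → ∃ λ w → w ∈ vs × Exact i u w
  exact-below {m} {u} v∈ e i i≤m = go (ℕₚ.≤⇒≤′ i≤m) v∈ e
    where
    go : ∀ {m v} → i ℕ.≤′ m → v ∈ vs → Exact m u v → ∃ λ w → w ∈ vs × Exact i u w
    go ℕ.≤′-refl v∈ e = _ , v∈ , e
    go (ℕ.≤′-step q) v∈ e with exact-pred e
    ... | w , w∈ , e′ = go q w∈ e′

  -- A shortest walk visits pairwise distinct vertices, so the cut-off in the
  -- definition of dist is never reached.
  exact-< : ∀ {m u v} → v ∈ vs → Exact m u v → m < length vs
  exact-< {m} {u} {v} v∈ e = Finₚ.injective⇒≤ {f = λ i → index (member i)} injective
    where
    vertex : Fin (suc m) → V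
    vertex i = proj₁ (exact-below v∈ e (toℕ i) (Finₚ.toℕ≤pred[n] i))
    member : ∀ i → vertex i ∈ vs
    member i = proj₁ (proj₂ (exact-below v∈ e (toℕ i) (Finₚ.toℕ≤pred[n] i)))
    isExact : ∀ i → Exact (toℕ i) u (vertex i)
    isExact i = proj₂ (proj₂ (exact-below v∈ e (toℕ i) (Finₚ.toℕ≤pred[n] i)))
    injective : ∀ {i j} → index (member i) ≡ index (member j) → i ≡ j
    injective {i} {j} p = Finₚ.toℕ-injective (ℕₚ.≤-antisym
        (proj₂ (isExact i) (toℕ j) (subst (Ball (toℕ j) u) (sym same) (proj₁ (isExact j))))
        (proj₂ (isExact j) (toℕ i) (subst (Ball (toℕ i) u) same (proj₁ (isExact i)))))
      where
      same : vertex i ≡ vertex j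
      same = trans (Anyₚ.lookup-index (member i))
               (trans (cong (L.lookup vs) p) (sym (Anyₚ.lookup-index (member j))))

  dist-≤ : ∀ {k u v} → Ball k u v → dist u v ≤ k
  dist-≤ {k} {u} {v} p = least-≤ (λ i → ball i u v) (length vs) k (holds p)

  dist-ball : ∀ {k u v} → v ∈ vs → Ball k u v → Ball (dist u v) u v
  dist-ball {k} {u} {v} v∈ p with exact p
  ... | m , e = ⟨ least-true (λ i → ball i u v) (length vs)
                  (ℕₚ.≤-<-trans (dist-≤ (proj₁ e)) (exact-< v∈ e)) ⟩

module GraphMetric (G : Graph) where

  open Graph G
  open DistProperties (allFin n) adj (λ u v → ⌊ u Finₚ.≟ v ⌋)
         (λ u → fromWitness refl) (λ u v → toWitness) public

  T-adj-sym : ∀ u v → T (adj u v) → T (adj v u)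
  T-adj-sym u v = subst T (adj-sym u v)

  walk-ball : ∀ {u v k} → Walk adj u v k → Ball k u v
  walk-ball here = ball-refl _
  walk-ball (step a p) = ball-trans
    (ball-step (∈-allFin _) (ball-refl _) (Equivalence.from T-≡ a)) (walk-ball p)

  d-ball : ∀ u v → Ball (d G u v) u v
  d-ball u v = dist-ball (∈-allFin v) (walk-ball (proj₂ (connected u v)))

  d-refl : ∀ u → d G u u ≡ 0
  d-refl u = ℕₚ.n≤0⇒n≡0 (dist-≤ (ball-refl u))

  d-zero : ∀ u v → d G u v ≤ 0 → u ≡ v
  d-zero u v p = ball-zero (ball-mono p (d-ball u v))

  d-tri : ∀ u v w → d G u w ≤ d G u v ℕ.+ d G v w
  d-tri u v w = dist-≤ (ball-trans (d-ball u v) (d-ball v w))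

  d-sym : ∀ u v → d G u v ≡ d G v u
  d-sym u v = ℕₚ.≤-antisym (half u v) (half v u)
    where
    half : ∀ u v → d G u v ≤ d G v u
    half u v = dist-≤ (ball-sym T-adj-sym (d G v u) (∈-allFin _) (d-ball v u))

  d-between : ∀ {u v} i j → d G u v ≤ i ℕ.+ j → ∃ λ w → d G u w ≤ i × d G w v ≤ j
  d-between {u} {v} i j p with ball-split i j (ball-mono p (d-ball u v))
  ... | w , q , r = w , dist-≤ q , dist-≤ r

  -- On a shortest path of length at most r + r' some vertex lies within r of one end and r' of the
  -- other. So two disks meet as soon as their radii add up to the distance of their centres, and
  -- the Helly property takes a purely metric form.
  disks-meet : Helly G → (F : List (Vx G × ℕ)) →
    (∀ {v r v′ r′} → (v , r) ∈ F → (v′ , r′) ∈ F → d G v v′ ≤ r ℕ.+ r′) →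
    ∃ λ u → ∀ {v r} → (v , r) ∈ F → d G v u ≤ r
  disks-meet helly F p = proj₁ common , λ {v} {r} → proj₂ common {v , r}
    where
    pairwise : ∀ {D₁ D₂} → D₁ ∈ F → D₂ ∈ F → ∃ λ u → InDisk G u D₁ × InDisk G u D₂
    pairwise {v , r} {v′ , r′} m₁ m₂ =
      proj₁ w , proj₁ (proj₂ w) , subst (_≤ r′) (d-sym (proj₁ w) v′) (proj₂ (proj₂ w))
      where w = d-between r r′ (p {v} {r} {v′} {r′} m₁ m₂)
    common : ∃ λ u → ∀ {D} → D ∈ F → InDisk G u D
    common = helly F pairwise

-- The plane with the maximum metric

δ : Pt → Pt → ℕ
δ p q = ∣ proj₁ p ℤ.- proj₁ q ∣ ℕ.⊔ ∣ proj₂ p ℤ.- proj₂ q ∣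

i≤∣i∣ : ∀ i → i ℤ.≤ + ∣ i ∣
i≤∣i∣ (+ n)    = ℤₚ.≤-refl
i≤∣i∣ -[1+ n ] = ℤ.-≤+

∣i∣≤ : ∀ i m → i ℤ.≤ m → ℤ.- i ℤ.≤ m → + ∣ i ∣ ℤ.≤ m
∣i∣≤ (+ n)    m p q = p
∣i∣≤ -[1+ n ] m p q = q

∣x-y∣-bounds : ∀ x y {m} → ∣ x ℤ.- y ∣ ℕ.≤ m → (x ℤ.≤ y ℤ.+ + m) × (y ℤ.≤ x ℤ.+ + m)
∣x-y∣-bounds x y {m} p =
  lia 3 (λ x y m → x ⊖ y ≼ m ⇒ x ≼ y ⊕ m) refl x y (+ m) (ℤₚ.≤-trans (i≤∣i∣ (x ℤ.- y)) (+≤+ p)) ,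
  lia 3 (λ x y m → y ⊖ x ≼ m ⇒ y ≼ x ⊕ m) refl x y (+ m)
    (ℤₚ.≤-trans (i≤∣i∣ (y ℤ.- x)) (+≤+ (subst (ℕ._≤ m) (ℤₚ.∣i-j∣≡∣j-i∣ x y) p)))

δ-bounds : ∀ p q → ((proj₁ p ℤ.≤ proj₁ q ℤ.+ + δ p q) × (proj₁ q ℤ.≤ proj₁ p ℤ.+ + δ p q)) ×
                   ((proj₂ p ℤ.≤ proj₂ q ℤ.+ + δ p q) × (proj₂ q ℤ.≤ proj₂ p ℤ.+ + δ p q))
δ-bounds (x , y) (x′ , y′) =
  ∣x-y∣-bounds x x′ (ℕₚ.m≤m⊔n ∣ x ℤ.- x′ ∣ ∣ y ℤ.- y′ ∣) ,
  ∣x-y∣-bounds y y′ (ℕₚ.m≤n⊔m ∣ x ℤ.- x′ ∣ ∣ y ℤ.- y′ ∣)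

-- The condition `δ p q` ≤ m without maximum and absolute values, so that linear formulas can
-- express it.
Within : ℤ → Pt → Pt → Set
Within m (x , y) (x′ , y′) =
  ((x ℤ.≤ x′ ℤ.+ m) × (x′ ℤ.≤ x ℤ.+ m)) × ((y ℤ.≤ y′ ℤ.+ m) × (y′ ℤ.≤ y ℤ.+ m))

δ-≤ : ∀ p q m → Within m p q → + δ p q ℤ.≤ m
δ-≤ (x , y) (x′ , y′) m ((a , b) , (c , e)) =
  lub (∣ x ℤ.- x′ ∣) (∣ y ℤ.- y′ ∣) (coordinate x x′ a b) (coordinate y y′ c e)
  where
  coordinate : ∀ x y → x ℤ.≤ y ℤ.+ m → y ℤ.≤ x ℤ.+ m → + ∣ x ℤ.- y ∣ ℤ.≤ m
  coordinate x y p q = ∣i∣≤ (x ℤ.- y) m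
    (lia 3 (λ x y m → x ≼ y ⊕ m ⇒ x ⊖ y ≼ m) refl x y m p)
    (subst (ℤ._≤ m) (ℤₚ.+-identityˡ (ℤ.- (x ℤ.- y)))
      (lia 3 (λ x y m → y ≼ x ⊕ m ⇒ con (+ 0) ⊖ (x ⊖ y) ≼ m) refl x y m q))
  lub : ∀ i j → + i ℤ.≤ m → + j ℤ.≤ m → + (i ℕ.⊔ j) ℤ.≤ m
  lub i j p q with ℕₚ.⊔-sel i j
  ... | inj₁ r rewrite r = p
  ... | inj₂ r rewrite r = q

δ-sym : ∀ p q → δ p q ≡ δ q p
δ-sym p q = cong₂ ℕ._⊔_ (ℤₚ.∣i-j∣≡∣j-i∣ (proj₁ p) (proj₁ q)) (ℤₚ.∣i-j∣≡∣j-i∣ (proj₂ p) (proj₂ q))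

δ-refl : ∀ p → δ p p ≡ 0
δ-refl (x , y) rewrite ℤₚ.+-inverseʳ x | ℤₚ.+-inverseʳ y = refl

δ-tri : ∀ p q r → δ p r ℕ.≤ δ p q ℕ.+ δ q r
δ-tri p@(x , y) q@(x′ , y′) r@(x″ , y″) = ℤₚ.drop‿+≤+ (δ-≤ p r _
  (let (a , b) , (c , e) = δ-bounds p q
       (a′ , b′) , (c′ , e′) = δ-bounds q r
   in (upper x x′ x″ a a′ , lower x x′ x″ b b′) , (upper y y′ y″ c c′ , lower y y′ y″ e e′)))
  where
  m = + δ p q
  m′ = + δ q r
  upper : ∀ x x′ x″ → x ℤ.≤ x′ ℤ.+ m → x′ ℤ.≤ x″ ℤ.+ m′ → x ℤ.≤ x″ ℤ.+ (m ℤ.+ m′)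
  upper x x′ x″ = lia 5 (λ x x′ x″ m m′ → x ≼ x′ ⊕ m ⇒ x′ ≼ x″ ⊕ m′ ⇒ x ≼ x″ ⊕ (m ⊕ m′)) refl x x′ x″ m m′
  lower : ∀ x x′ x″ → x′ ℤ.≤ x ℤ.+ m → x″ ℤ.≤ x′ ℤ.+ m′ → x″ ℤ.≤ x ℤ.+ (m ℤ.+ m′)
  lower x x′ x″ = lia 5 (λ x x′ x″ m m′ → x′ ≼ x ⊕ m ⇒ x″ ≼ x′ ⊕ m′ ⇒ x″ ≼ x ⊕ (m ⊕ m′)) refl x x′ x″ m m′

-- p ↑ q (p ↗ q) means that the distance from p to q is attained by Δy ≥ 0 (Δx ≥ 0).
-- In the coordinates x + y and x - y of the problem both are product orders.
_↑_ _↗_ : Pt → Pt → Set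
(x , y) ↑ (x′ , y′) = (x′ ℤ.- x ℤ.≤ y′ ℤ.- y) × (x ℤ.- x′ ℤ.≤ y′ ℤ.- y)
(x , y) ↗ (x′ , y′) = (y′ ℤ.- y ℤ.≤ x′ ℤ.- x) × (y ℤ.- y′ ℤ.≤ x′ ℤ.- x)

within-↑ : ∀ p q → p ↑ q → Within (proj₂ q ℤ.- proj₂ p) p q
within-↑ (x , y) (x′ , y′) (a , b) = lia 4 (λ x y x′ y′ →
    x′ ⊖ x ≼ y′ ⊖ y ⇒ x ⊖ x′ ≼ y′ ⊖ y ⇒
    (x ≼ x′ ⊕ (y′ ⊖ y) ∧′ x′ ≼ x ⊕ (y′ ⊖ y)) ∧′ (y ≼ y′ ⊕ (y′ ⊖ y) ∧′ y′ ≼ y ⊕ (y′ ⊖ y)))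
  refl x y x′ y′ a b

within-↗ : ∀ p q → p ↗ q → Within (proj₁ q ℤ.- proj₁ p) p q
within-↗ (x , y) (x′ , y′) (a , b) = lia 4 (λ x y x′ y′ →
    y′ ⊖ y ≼ x′ ⊖ x ⇒ y ⊖ y′ ≼ x′ ⊖ x ⇒
    (x ≼ x′ ⊕ (x′ ⊖ x) ∧′ x′ ≼ x ⊕ (x′ ⊖ x)) ∧′ (y ≼ y′ ⊕ (x′ ⊖ x) ∧′ y′ ≼ y ⊕ (x′ ⊖ x)))
  refl x y x′ y′ a b

δ-↑ : ∀ p q → p ↑ q → + δ p q ≡ proj₂ q ℤ.- proj₂ p
δ-↑ p q h = ℤₚ.≤-antisym (δ-≤ p q _ (within-↑ p q h))
  (lia 3 (λ y y′ m → y′ ≼ y ⊕ m ⇒ y′ ⊖ y ≼ m) refl (proj₂ p) (proj₂ q) (+ δ p q)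
    (proj₂ (proj₂ (δ-bounds p q))))

δ-↗ : ∀ p q → p ↗ q → + δ p q ≡ proj₁ q ℤ.- proj₁ p
δ-↗ p q h = ℤₚ.≤-antisym (δ-≤ p q _ (within-↗ p q h))
  (lia 3 (λ y y′ m → y′ ≼ y ⊕ m ⇒ y′ ⊖ y ≼ m) refl (proj₁ p) (proj₁ q) (+ δ p q)
    (proj₂ (proj₁ (δ-bounds p q))))

comparable : ∀ p q → ((p ↑ q) ⊎ (q ↑ p)) ⊎ ((p ↗ q) ⊎ (q ↗ p))
comparable (x , y) (x′ , y′) = lia 4 (λ x y x′ y′ →
    ((x′ ⊖ x ≼ y′ ⊖ y ∧′ x ⊖ x′ ≼ y′ ⊖ y) ∨′ (x ⊖ x′ ≼ y ⊖ y′ ∧′ x′ ⊖ x ≼ y ⊖ y′)) ∨′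
    ((y′ ⊖ y ≼ x′ ⊖ x ∧′ y ⊖ y′ ≼ x′ ⊖ x) ∨′ (y ⊖ y′ ≼ x ⊖ x′ ∧′ y′ ⊖ y ≼ x ⊖ x′)))
  refl x y x′ y′

-- Points, orders and the vertex set of H₃ᵏ as linear formulas

Point : ℕ → Set
Point n = Expr n × Expr n

within : ∀ {n} → Expr n → Point n → Point n → Form n
within m (x , y) (x′ , y′) = (x ≼ x′ ⊕ m ∧′ x′ ≼ x ⊕ m) ∧′ (y ≼ y′ ⊕ m ∧′ y′ ≼ y ⊕ m)

up right : ∀ {n} → Point n → Point n → Form n
up (x , y) (x′ , y′) = x′ ⊖ x ≼ y′ ⊖ y ∧′ x ⊖ x′ ≼ y′ ⊖ y
right (x , y) (x′ , y′) = y′ ⊖ y ≼ x′ ⊖ x ∧′ y ⊖ y′ ≼ x′ ⊖ x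

triangle : ∀ {n} → Expr n → Expr n → Expr n → Form n
triangle xy xz yz = xy ≼ xz ⊕ yz ∧′ xz ≼ xy ⊕ yz ∧′ yz ≼ xy ⊕ xz

metric : ∀ {n} (ab ac ae bc be ce : Expr n) → Form n
metric ab ac ae bc be ce =
  triangle ab ac bc ∧′ triangle ab ae be ∧′ triangle ac ae ce ∧′ triangle bc be ce

coreF tipAF tipBF tipCF tipDF : ∀ {n} → Expr n → Point n → Form n
coreF k (x , y) = (con (+ 0) ≼ x ⊕ y ∧′ x ⊕ y ≼ k ⊕ k ⊕ con (+ 2)) ∧′
                  (con -[1+ 0 ] ≼ x ⊖ y ∧′ x ⊖ y ≼ k ⊕ k ⊕ con (+ 1))
tipAF k (x , y) = x ≈ k ∧′ y ≈ con -[1+ 0 ] ⊖ k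
tipBF k (x , y) = x ≈ con -[1+ 0 ] ∧′ y ≈ con (+ 1)
tipCF k (x , y) = x ≈ k ⊕ con (+ 1) ∧′ y ≈ k ⊕ con (+ 2)
tipDF k (x , y) = x ≈ k ⊕ k ⊕ con (+ 2) ∧′ y ≈ con (+ 0)

-- `Core` is a square in x + y and x - y whose corners have coordinates of different parity and so
-- are no lattice points. Each tip is a lattice point one unit beyond a corner: A at the bottom, B
-- on the left, C at the top, D on the right.
Core TipA TipB TipC TipD Region : ℤ → Pt → Set
Core k (x , y) = ((+ 0 ℤ.≤ x ℤ.+ y) × (x ℤ.+ y ℤ.≤ k ℤ.+ k ℤ.+ + 2)) ×
                 ((-[1+ 0 ] ℤ.≤ x ℤ.- y) × (x ℤ.- y ℤ.≤ k ℤ.+ k ℤ.+ + 1))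
TipA k (x , y) = (x ≡ k) × (y ≡ -[1+ 0 ] ℤ.- k)
TipB k (x , y) = (x ≡ -[1+ 0 ]) × (y ≡ + 1)
TipC k (x , y) = (x ≡ k ℤ.+ + 1) × (y ≡ k ℤ.+ + 2)
TipD k (x , y) = (x ≡ k ℤ.+ k ℤ.+ + 2) × (y ≡ + 0)
Region k p = Core k p ⊎ TipA k p ⊎ TipB k p ⊎ TipC k p ⊎ TipD k p

regionF : ∀ {n} → Expr n → Point n → Form n
regionF k p = coreF k p ∨′ tipAF k p ∨′ tipBF k p ∨′ tipCF k p ∨′ tipDF k p

1≰0 : ¬ (+ 1 ℤ.≤ + 0)
1≰0 (+≤+ ())

-- Parity of natural numbers

half : ∀ n → ∃ λ m → (n ≡ m ℕ.+ m) ⊎ (n ≡ suc (m ℕ.+ m))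
half zero = 0 , inj₁ refl
half (suc n) with half n
... | m , inj₁ p = m , inj₂ (cong suc p)
... | m , inj₂ p = suc m , inj₁ (cong suc (trans p (sym (ℕₚ.+-suc m m))))

odd-%2 : ∀ k → suc (k ℕ.+ k) % 2 ≡ 1
odd-%2 k = trans (cong (λ i → suc i % 2) (trans (cong (k ℕ.+_) (sym (ℕₚ.+-identityʳ k))) (ℕₚ.*-comm 2 k)))
                 ([m+kn]%n≡m%n 1 k 2)

odd-halves : ∀ n → n % 2 ≡ 1 → n ≡ suc (⌊ n /2⌋ ℕ.+ ⌊ n /2⌋)
odd-halves n h with half n
... | k , inj₂ refl = cong (λ i → suc (i ℕ.+ i)) (ℕₚ.n≡⌈n+n/2⌉ k)
... | k , inj₁ refl with trans (sym h) (trans (cong (_% 2)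
        (trans (cong (k ℕ.+_) (sym (ℕₚ.+-identityʳ k))) (ℕₚ.*-comm 2 k))) ([m+kn]%n≡m%n 0 k 2))
...   | ()

-- Helly metric spaces

module Helly-space {V : Set} (d : V → V → ℕ) (d-refl : ∀ u → d u u ≡ 0)
  (d-zero : ∀ u v → d u v ℕ.≤ 0 → u ≡ v) (d-sym : ∀ u v → d u v ≡ d v u)
  (d-tri : ∀ u v w → d u w ℕ.≤ d u v ℕ.+ d v w)
  (disks-meet : (F : List (V × ℕ)) →
    (∀ {v r v′ r′} → (v , r) ∈ F → (v′ , r′) ∈ F → d v v′ ℕ.≤ r ℕ.+ r′) →
    ∃ λ u → ∀ {v r} → (v , r) ∈ F → d v u ℕ.≤ r)
  where

  D : V → V → ℤ
  D u v = + d u v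

  D-tri : ∀ u v w → D u w ℤ.≤ D u v ℤ.+ D v w
  D-tri u v w = +≤+ (d-tri u v w)

  D-sym : ∀ u v → D u v ≡ D v u
  D-sym u v = cong +_ (d-sym u v)

  _∼_ : Pt × V → Pt × V → Set
  (p , u) ∼ (q , v) = d u v ℕ.≤ δ p q

  -- L is the graph of a finite partial map from the plane to V.
  Lipschitz : List (Pt × V) → Set
  Lipschitz L = ∀ {s t} → s ∈ L → t ∈ L → s ∼ t

  lipschitz : ∀ {L} → AllPairs _∼_ L → Lipschitz L
  lipschitz (h ∷ hs) {p , u} (here refl) (here refl) = ℕₚ.≤-trans (ℕₚ.≤-reflexive (d-refl u)) z≤n
  lipschitz (h ∷ hs) (here refl) (there t∈) = All.lookup h t∈
  lipschitz (h ∷ hs) {p , u} {q , v} (there s∈) (here refl) =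
    subst₂ ℕ._≤_ (d-sym v u) (δ-sym q p) (All.lookup h s∈)
  lipschitz (h ∷ hs) (there s∈) (there t∈) = lipschitz hs s∈ t∈

  -- The image of p has to lie in the disk of radius `δ p q` around the image of every earlier q.
  -- The Lipschitz condition and the triangle inequality in the plane, d v v' ≤ δ q q' ≤ δ q p + δ p
  -- q', make these disks meet pairwise.
  extend : ∀ {L} → AllPairs _∼_ L → ∀ p → ∃ λ v → AllPairs _∼_ ((p , v) ∷ L)
  extend {L} h p = proj₁ common , All.tabulate close ∷ h
    where
    disk : Pt × V → V × ℕ
    disk (q , v) = v , δ p q
    pairwise : ∀ {v r v′ r′} → (v , r) ∈ map disk L → (v′ , r′) ∈ map disk L → d v v′ ℕ.≤ r ℕ.+ r′
    pairwise m m′ with ∈-map⁻ disk m | ∈-map⁻ disk m′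
    ... | (q , v) , s∈ , refl | (q′ , v′) , t∈ , refl = ℕₚ.≤-trans (lipschitz h s∈ t∈)
          (subst (λ i → δ q q′ ℕ.≤ i ℕ.+ δ p q′) (δ-sym q p) (δ-tri q p q′))
    common = disks-meet (map disk L) pairwise
    close : ∀ {t} → t ∈ L → (p , proj₁ common) ∼ t
    close {q , v} t∈ = subst (ℕ._≤ δ p q) (d-sym v (proj₁ common)) (proj₂ common (∈-map⁺ disk t∈))

  extendAll : ∀ {L} → AllPairs _∼_ L → ∀ ps →
    ∃ λ L′ → AllPairs _∼_ L′ × (∀ {s} → s ∈ L → s ∈ L′) × (∀ {p} → p ∈ ps → ∃ λ v → (p , v) ∈ L′)
  extendAll {L} h [] = L , h , (λ s∈ → s∈) , λ ()
  extendAll h (p ∷ ps) with extendAll h ps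
  ... | L′ , h′ , L⊆L′ , hit with extend h′ p
  ...   | v , h″ = _ , h″ , (λ s∈ → there (L⊆L′ s∈)) ,
            λ { (here refl) → v , here refl ; (there p∈) → let w , w∈ = hit p∈ in w , there w∈ }

  evaluate : V → List (Pt × V) → Pt → V
  evaluate v₀ [] p = v₀
  evaluate v₀ ((q , v) ∷ L) p with ≡-dec ℤ._≟_ ℤ._≟_ p q
  ... | yes _ = v
  ... | no _  = evaluate v₀ L p

  -- A point may be listed twice, for instance as a corner and as a member of `ps`. It is enough
  -- that the value found is one that the list pairs with p.
  evaluate-∈ : ∀ v₀ L {p v} → (p , v) ∈ L → (p , evaluate v₀ L p) ∈ L
  evaluate-∈ v₀ ((q , w) ∷ L) {p} m with ≡-dec ℤ._≟_ ℤ._≟_ p q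
  ... | yes refl = here refl
  evaluate-∈ v₀ ((q , w) ∷ L) (here refl) | no ¬e = contradiction refl ¬e
  evaluate-∈ v₀ ((q , w) ∷ L) (there m)   | no ¬e = there (evaluate-∈ v₀ L m)

  -- Along a monotone chain P, p, q, Q whose ends are as far apart in V as in
  -- the plane no distance can shrink.
  tight : ∀ {L} → Lipschitz L → ∀ (π : Pt → ℤ) {P s p u q v Q t} →
    (P , s) ∈ L → (p , u) ∈ L → (q , v) ∈ L → (Q , t) ∈ L →
    + δ P p ≡ π p ℤ.- π P → + δ p q ≡ π q ℤ.- π p → + δ q Q ≡ π Q ℤ.- π q →
    π Q ℤ.- π P ℤ.≤ D s t → D u v ≡ π q ℤ.- π p
  tight h π {P} {s} {p} {u} {q} {v} {Q} {t} P∈ p∈ q∈ Q∈ e₁ e₂ e₃ far =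
    lia 9 (λ i j k l st su uv vt sv →
      su ≼ j ⊖ i ⇒ uv ≼ k ⊖ j ⇒ vt ≼ l ⊖ k ⇒ l ⊖ i ≼ st ⇒ st ≼ sv ⊕ vt ⇒ sv ≼ su ⊕ uv ⇒ uv ≈ k ⊖ j)
      refl (π P) (π p) (π q) (π Q) (D s t) (D s u) (D u v) (D v t) (D s v)
      (bound e₁ (h P∈ p∈)) (bound e₂ (h p∈ q∈)) (bound e₃ (h q∈ Q∈)) far
      (D-tri s v t) (D-tri s u v)
    where
    bound : ∀ {m n z} → + n ≡ z → m ℕ.≤ n → + m ℤ.≤ z
    bound refl p = +≤+ p

  tight-↑ : ∀ {L} → Lipschitz L → ∀ {P s p u q v Q t} →
    (P , s) ∈ L → (p , u) ∈ L → (q , v) ∈ L → (Q , t) ∈ L →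
    P ↑ p → p ↑ q → q ↑ Q → proj₂ Q ℤ.- proj₂ P ℤ.≤ D s t → D u v ≡ proj₂ q ℤ.- proj₂ p
  tight-↑ h {P} {s} {p} {u} {q} {v} {Q} {t} P∈ p∈ q∈ Q∈ a b c =
    tight h proj₂ {P} {s} {p} {u} {q} {v} {Q} {t} P∈ p∈ q∈ Q∈ (δ-↑ P p a) (δ-↑ p q b) (δ-↑ q Q c)

  tight-↗ : ∀ {L} → Lipschitz L → ∀ {P s p u q v Q t} →
    (P , s) ∈ L → (p , u) ∈ L → (q , v) ∈ L → (Q , t) ∈ L →
    P ↗ p → p ↗ q → q ↗ Q → proj₁ Q ℤ.- proj₁ P ℤ.≤ D s t → D u v ≡ proj₁ q ℤ.- proj₁ p
  tight-↗ h {P} {s} {p} {u} {q} {v} {Q} {t} P∈ p∈ q∈ Q∈ a b c =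
    tight h proj₁ {P} {s} {p} {u} {q} {v} {Q} {t} P∈ p∈ q∈ Q∈ (δ-↗ P p a) (δ-↗ p q b) (δ-↗ q Q c)

  Slice : ℤ → Set
  Slice m = ∃ λ x → ∃ λ y → ∃ λ u → ∃ λ v →
    (D x u ℤ.+ D u y ≡ D x y) × (D x v ℤ.+ D v y ≡ D x y) × (D x u ≡ D x v) × (m ℤ.≤ D u v)

  -- Upper bounds suffice: since x and y are at least i + j apart, the triangle inequalities through
  -- u and through v turn all four bounds into equalities.
  slice : ∀ {x y u v} (i j m : ℤ) → D x u ℤ.≤ i → D u y ℤ.≤ j → D x v ℤ.≤ i → D v y ℤ.≤ j →
          i ℤ.+ j ℤ.≤ D x y → m ℤ.≤ D u v → Slice m
  slice {x} {y} {u} {v} i j m xu uy xv vy xy uv = x , y , u , v ,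
    proj₁ eqs , proj₁ (proj₂ eqs) , proj₂ (proj₂ eqs) , uv
    where
    eqs = lia 7 (λ i j xu uy xv vy xy →
      xu ≼ i ⇒ uy ≼ j ⇒ xv ≼ i ⇒ vy ≼ j ⇒ i ⊕ j ≼ xy ⇒ xy ≼ xu ⊕ uy ⇒ xy ≼ xv ⊕ vy ⇒
      (xu ⊕ uy ≈ xy ∧′ xv ⊕ vy ≈ xy ∧′ xu ≈ xv)) refl
      i j (D x u) (D u y) (D x v) (D v y) (D x y) xu uy xv vy xy (D-tri x u y) (D-tri x v y)

  -- An isometric embedding of the four points into the plane (up to a translation).
  -- With S = D a c + D b e the largest of the three sums, A, C are joined by a chain
  -- in the direction ↑ and E, B by one in the direction ↗.
  module Embedding (a b c e : V) (ox oy : ℤ) where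

    A B C E : Pt
    A = ox , oy
    B = ox ℤ.+ D a b , oy ℤ.+ D a c ℤ.- D b c
    C = ox ℤ.+ D a b ℤ.+ D c e ℤ.- D b e , oy ℤ.+ D a c
    E = ox ℤ.+ D a b ℤ.- D b e , oy ℤ.+ D a e

    corners : List (Pt × V)
    corners = (A , a) ∷ (B , b) ∷ (C , c) ∷ (E , e) ∷ []

    -- Each of the six distances occurs literally as a difference of coordinates: AB, BE and CE in
    -- x, the other three in y.
    corners-∼ : AllPairs _∼_ corners
    corners-∼ =
      (drop (lia 3 (λ x t m → x ⊕ t ≼ x ⊕ m ⇒ t ≼ m) refl ox (D a b) (+ δ A B) (proj₂ (proj₁ (δ-bounds A B)))) ∷
       drop (lia 3 (λ x t m → x ⊕ t ≼ x ⊕ m ⇒ t ≼ m) refl oy (D a c) (+ δ A C) (proj₂ (proj₂ (δ-bounds A C)))) ∷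
       drop (lia 3 (λ x t m → x ⊕ t ≼ x ⊕ m ⇒ t ≼ m) refl oy (D a e) (+ δ A E) (proj₂ (proj₂ (δ-bounds A E)))) ∷ []) ∷
      (drop (lia 4 (λ x s t m → x ⊕ s ≼ (x ⊕ s ⊖ t) ⊕ m ⇒ t ≼ m) refl oy (D a c) (D b c) (+ δ B C)
              (proj₂ (proj₂ (δ-bounds B C)))) ∷
       drop (lia 4 (λ x s t m → x ⊕ s ≼ (x ⊕ s ⊖ t) ⊕ m ⇒ t ≼ m) refl ox (D a b) (D b e) (+ δ B E)
              (proj₁ (proj₁ (δ-bounds B E)))) ∷ []) ∷
      (drop (lia 5 (λ x s t r m → x ⊕ s ⊕ t ⊖ r ≼ (x ⊕ s ⊖ r) ⊕ m ⇒ t ≼ m) refl ox (D a b) (D c e) (D b e) (+ δ C E)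
              (proj₁ (proj₁ (δ-bounds C E)))) ∷ []) ∷
      [] ∷ []
      where
      drop : ∀ {m n} → + m ℤ.≤ + n → m ℕ.≤ n
      drop = ℤₚ.drop‿+≤+

    ac-span : proj₂ C ℤ.- proj₂ A ℤ.≤ D a c
    ac-span = lia 2 (λ x t → x ⊕ t ⊖ x ≼ t) refl oy (D a c)

    eb-span : proj₁ B ℤ.- proj₁ E ℤ.≤ D e b
    eb-span = subst (λ t → proj₁ B ℤ.- proj₁ E ℤ.≤ t) (D-sym b e)
      (lia 3 (λ x s t → x ⊕ s ⊖ (x ⊕ s ⊖ t) ≼ t) refl ox (D a b) (D b e))

    -- The images of p, q on the chain from A to C and of r, s on the chain from E to B. Distances
    -- along a chain are exact; those between the chains are only bounded above, as `slice`
    -- requires.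
    record Cross (p q r s : Pt) : Set where
      field
        p′ q′ r′ s′ : V
        pq : D p′ q′ ≡ proj₂ q ℤ.- proj₂ p
        rs : D r′ s′ ≡ proj₁ s ℤ.- proj₁ r
        pr : D p′ r′ ℤ.≤ + δ p r
        ps : D p′ s′ ℤ.≤ + δ p s
        qr : D q′ r′ ℤ.≤ + δ q r
        qs : D q′ s′ ℤ.≤ + δ q s

    cross : ∀ p q r s → A ↑ p → p ↑ q → q ↑ C → E ↗ r → r ↗ s → s ↗ B → Cross p q r s
    cross p q r s Ap pq qC Er rs sB with extend corners-∼ p
    ... | p′ , h₁ with extend h₁ q
    ...   | q′ , h₂ with extend h₂ r
    ...     | r′ , h₃ with extend h₃ s
    ...       | s′ , h₄ = record
      { p′ = p′ ; q′ = q′ ; r′ = r′ ; s′ = s′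
      ; pq = tight-↑ L {A} {a} {p} {p′} {q} {q′} {C} {c}
               (there (there (there (there (here refl))))) p∈ q∈
               (there (there (there (there (there (there (here refl))))))) Ap pq qC ac-span
      ; rs = tight-↗ L {E} {e} {r} {r′} {s} {s′} {B} {b}
               (there (there (there (there (there (there (there (here refl)))))))) r∈ s∈
               (there (there (there (there (there (here refl)))))) Er rs sB eb-span
      ; pr = +≤+ (L p∈ r∈) ; ps = +≤+ (L p∈ s∈) ; qr = +≤+ (L q∈ r∈) ; qs = +≤+ (L q∈ s∈) }
      where
      L = lipschitz h₄
      p∈ = there (there (there (here refl)))
      q∈ = there (there (here refl))
      r∈ = there (here refl)
      s∈ = here refl

  triangles : ∀ x y z → (D x y ℤ.≤ D x z ℤ.+ D y z) × (D x z ℤ.≤ D x y ℤ.+ D y z) × (D y z ℤ.≤ D x y ℤ.+ D x z)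
  triangles x y z =
    subst (λ t → D x y ℤ.≤ D x z ℤ.+ t) (D-sym z y) (D-tri x z y) , D-tri x y z ,
    subst (λ t → D y z ℤ.≤ t ℤ.+ D x z) (D-sym y x) (D-tri y x z)

  metric-holds = λ a b c e → triangles a b c ,′ triangles a b e ,′ triangles a c e ,′ triangles b c e

  module _ (a b c e : V) where

    open Embedding a b c e (+ 0) (+ 0)

    -- P, S, Q, R are the consecutive corners of a square of side w in the rectangle
    -- bounded by A, B, C, E; the shift s makes them lattice points.
    even-slice : ∀ w β s → + 0 ℤ.≤ w →
      D a c ℤ.+ D b e ≡ w ℤ.+ w ℤ.+ (D a b ℤ.+ D c e) →
      β ℤ.+ β ≡ s ℤ.+ (D a b ℤ.+ D a e ℤ.- D b e) →
      + 0 ℤ.≤ s → s ℤ.≤ D a b ℤ.+ D c e ℤ.- (D a e ℤ.+ D b c) → Slice (w ℤ.+ w)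
    even-slice w β s w≥0 gap base s≥0 s≤ = slice w w (w ℤ.+ w)
        (ℤₚ.≤-trans pr (δ-≤ P R w (lia 2 (λ β w → con (+ 0) ≼ w ⇒ within w (β , β) (β ⊖ w , β ⊕ w)) refl β w w≥0)))
        (subst (ℤ._≤ w) (D-sym q′ r′) (ℤₚ.≤-trans qr (δ-≤ Q R w
          (lia 2 (λ β w → con (+ 0) ≼ w ⇒ within w (β , β ⊕ (w ⊕ w)) (β ⊖ w , β ⊕ w)) refl β w w≥0))))
        (ℤₚ.≤-trans ps (δ-≤ P S w (lia 2 (λ β w → con (+ 0) ≼ w ⇒ within w (β , β) (β ⊕ w , β ⊕ w)) refl β w w≥0)))
        (subst (ℤ._≤ w) (D-sym q′ s′) (ℤₚ.≤-trans qs (δ-≤ Q S w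
          (lia 2 (λ β w → con (+ 0) ≼ w ⇒ within w (β , β ⊕ (w ⊕ w)) (β ⊕ w , β ⊕ w)) refl β w w≥0))))
        (ℤₚ.≤-reflexive (trans (lia 2 (λ β w → w ⊕ w ≈ (β ⊕ (w ⊕ w)) ⊖ β) refl β w) (sym pq)))
        (ℤₚ.≤-reflexive (trans (lia 2 (λ β w → w ⊕ w ≈ (β ⊕ w) ⊖ (β ⊖ w)) refl β w) (sym rs)))
      where
      P Q R S : Pt
      P = β , β
      Q = β , β ℤ.+ (w ℤ.+ w)
      R = β ℤ.- w , β ℤ.+ w
      S = β ℤ.+ w , β ℤ.+ w
      cones = lia 9 (λ ab ac ae bc be ce w β s →
        let o = con (+ 0)
            A = o , o
            B = o ⊕ ab , o ⊕ ac ⊖ bc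
            C = o ⊕ ab ⊕ ce ⊖ be , o ⊕ ac
            E = o ⊕ ab ⊖ be , o ⊕ ae
            P = β , β
            Q = β , β ⊕ (w ⊕ w)
            R = β ⊖ w , β ⊕ w
            S = β ⊕ w , β ⊕ w
        in metric ab ac ae bc be ce ⇒ con (+ 0) ≼ w ⇒ ac ⊕ be ≈ w ⊕ w ⊕ (ab ⊕ ce) ⇒
           β ⊕ β ≈ s ⊕ (ab ⊕ ae ⊖ be) ⇒ con (+ 0) ≼ s ⇒ s ≼ ab ⊕ ce ⊖ (ae ⊕ bc) ⇒
           up A P ∧′ up P Q ∧′ up Q C ∧′ right E R ∧′ right R S ∧′ right S B)
        refl (D a b) (D a c) (D a e) (D b c) (D b e) (D c e) w β s (metric-holds a b c e) w≥0 gap base s≥0 s≤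
      crossing : Cross P Q R S
      crossing = let (p , q , r , s , t , u) = cones in cross P Q R S p q r s t u
      open Cross crossing

    -- Only two opposite corners P, Q of the square are lattice points; R and S are
    -- taken half a unit away from the other two, outside of the square.
    odd-slice : ∀ w α → + 0 ℤ.≤ w →
      D a c ℤ.+ D b e ≡ w ℤ.+ w ℤ.+ + 1 ℤ.+ (D a b ℤ.+ D c e) →
      α ℤ.+ α ≡ D a b ℤ.+ D a e ℤ.- D b e →
      D a e ℤ.+ D b c ℤ.≤ D a b ℤ.+ D c e → Slice (w ℤ.+ w ℤ.+ + 1)
    odd-slice w α w≥0 gap base order = result
      where
      m = w ℤ.+ + 1
      P Q R : Pt
      P = α , α
      Q = α , α ℤ.+ (w ℤ.+ m)
      R = α ℤ.- m , α ℤ.+ m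
      -- `right E R` rests on parity: x - y at E is at most -(2w + 1) by the triangle inequality and
      -- it is even, because x + y there is 2α. So it is at most -2m, its value at R.
      cones = lia 8 (λ ab ac ae bc be ce w α →
        let o = con (+ 0)
            m = w ⊕ con (+ 1)
            A = o , o
            C = o ⊕ ab ⊕ ce ⊖ be , o ⊕ ac
            E = o ⊕ ab ⊖ be , o ⊕ ae
            P = α , α
            Q = α , α ⊕ (w ⊕ m)
            R = α ⊖ m , α ⊕ m
        in metric ab ac ae bc be ce ⇒ o ≼ w ⇒ ac ⊕ be ≈ w ⊕ w ⊕ con (+ 1) ⊕ (ab ⊕ ce) ⇒
           α ⊕ α ≈ ab ⊕ ae ⊖ be ⇒ ae ⊕ bc ≼ ab ⊕ ce ⇒
           up A P ∧′ up P Q ∧′ up Q C ∧′ right E R)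
        refl (D a b) (D a c) (D a e) (D b c) (D b e) (D c e) w α (metric-holds a b c e) w≥0 gap base order
      build : ∀ S → (R ↗ S × m ℤ.+ m ℤ.≤ proj₁ S ℤ.- proj₁ R) → S ↗ B → Within m P S → Within m Q S →
              Slice (w ℤ.+ w ℤ.+ + 1)
      -- In contrast to `even-slice`, the outer points R and S are the ends, 2m apart, and P and Q
      -- are the middle pair at distance 2w + 1.
      build S (RS , long) SB PS QS = slice m m _
          (subst (ℤ._≤ m) (D-sym p′ r′) (ℤₚ.≤-trans pr (δ-≤ P R m
            (lia 2 (λ α w → let m = w ⊕ con (+ 1) in con (+ 0) ≼ w ⇒
              within m (α , α) (α ⊖ m , α ⊕ m)) refl α w w≥0))))
          (ℤₚ.≤-trans ps (δ-≤ P S m PS))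
          (subst (ℤ._≤ m) (D-sym q′ r′) (ℤₚ.≤-trans qr (δ-≤ Q R m
            (lia 2 (λ α w → let m = w ⊕ con (+ 1) in con (+ 0) ≼ w ⇒
              within m (α , α ⊕ (w ⊕ m)) (α ⊖ m , α ⊕ m)) refl α w w≥0))))
          (ℤₚ.≤-trans qs (δ-≤ Q S m QS))
          (ℤₚ.≤-trans long (ℤₚ.≤-reflexive (sym rs)))
          (ℤₚ.≤-reflexive (trans (lia 2 (λ α w → w ⊕ w ⊕ con (+ 1) ≈ (α ⊕ (w ⊕ (w ⊕ con (+ 1)))) ⊖ α) refl α w) (sym pq)))
        where
        crossing : Cross P Q R S
        crossing = let (p , q , r , s) = cones in cross P Q R S p q r s RS SB
        open Cross crossing
      result : Slice (w ℤ.+ w ℤ.+ + 1)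
      -- In a rectangle longer than the square, S moves along the long side and stays inside.
      -- Otherwise it leaves the rectangle with x - y = 1 and still precedes B, where x - y is
      -- nonnegative and odd.
      result with D a b ℤ.+ D c e ℤ.≤? D a e ℤ.+ D b c
      ... | no ≰ = build (α ℤ.+ m , α ℤ.+ m)
        (lia 2 (λ α w → let m = w ⊕ con (+ 1) in con (+ 0) ≼ w ⇒
          right (α ⊖ m , α ⊕ m) (α ⊕ m , α ⊕ m) ∧′ m ⊕ m ≼ (α ⊕ m) ⊖ (α ⊖ m)) refl α w w≥0)
        (lia 8 (λ ab ac ae bc be ce w α → let m = w ⊕ con (+ 1); o = con (+ 0) in
          metric ab ac ae bc be ce ⇒ o ≼ w ⇒ ac ⊕ be ≈ w ⊕ w ⊕ con (+ 1) ⊕ (ab ⊕ ce) ⇒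
          α ⊕ α ≈ ab ⊕ ae ⊖ be ⇒ con (+ 1) ⊕ (ae ⊕ bc) ≼ ab ⊕ ce ⇒
          right (α ⊕ m , α ⊕ m) (o ⊕ ab , o ⊕ ac ⊖ bc))
          refl (D a b) (D a c) (D a e) (D b c) (D b e) (D c e) w α (metric-holds a b c e) w≥0 gap base
          (ℤₚ.i<j⇒suc[i]≤j (ℤₚ.≰⇒> ≰)))
        (lia 2 (λ α w → let m = w ⊕ con (+ 1); o = con (+ 0) in o ≼ w ⇒
          within m (α , α) (α ⊕ m , α ⊕ m)) refl α w w≥0)
        (lia 2 (λ α w → let m = w ⊕ con (+ 1); o = con (+ 0) in o ≼ w ⇒
          within m (α , α ⊕ (w ⊕ m)) (α ⊕ m , α ⊕ m)) refl α w w≥0)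
      ... | yes ≤ = build (α ℤ.+ m , α ℤ.+ w)
        (lia 2 (λ α w → let m = w ⊕ con (+ 1) in con (+ 0) ≼ w ⇒
          right (α ⊖ m , α ⊕ m) (α ⊕ m , α ⊕ w) ∧′ m ⊕ m ≼ (α ⊕ m) ⊖ (α ⊖ m)) refl α w w≥0)
        (lia 8 (λ ab ac ae bc be ce w α → let m = w ⊕ con (+ 1); o = con (+ 0) in
          metric ab ac ae bc be ce ⇒ o ≼ w ⇒ ac ⊕ be ≈ w ⊕ w ⊕ con (+ 1) ⊕ (ab ⊕ ce) ⇒
          α ⊕ α ≈ ab ⊕ ae ⊖ be ⇒ ae ⊕ bc ≈ ab ⊕ ce ⇒
          right (α ⊕ m , α ⊕ w) (o ⊕ ab , o ⊕ ac ⊖ bc))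
          refl (D a b) (D a c) (D a e) (D b c) (D b e) (D c e) w α (metric-holds a b c e) w≥0 gap base
          (ℤₚ.≤-antisym order ≤))
        (lia 2 (λ α w → let m = w ⊕ con (+ 1); o = con (+ 0) in o ≼ w ⇒
          within m (α , α) (α ⊕ m , α ⊕ w)) refl α w w≥0)
        (lia 2 (λ α w → let m = w ⊕ con (+ 1); o = con (+ 0) in o ≼ w ⇒
          within m (α , α ⊕ (w ⊕ m)) (α ⊕ m , α ⊕ w)) refl α w w≥0)

  -- The extremal case: D a c + D b e exceeds both other sums by 2 k + 2, and the
  -- sides of the embedded square lie between the points of the lattice.
  module Extremal (a b c e : V) (k α : ℤ) (k≥0 : + 0 ℤ.≤ k)
    (gap : D a c ℤ.+ D b e ≡ (k ℤ.+ + 1) ℤ.+ (k ℤ.+ + 1) ℤ.+ (D a b ℤ.+ D c e))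
    (square : D a e ℤ.+ D b c ≡ D a b ℤ.+ D c e)
    (base : α ℤ.+ α ℤ.+ + 1 ≡ D a b ℤ.+ D a e ℤ.- D b e) where

    -- This translation moves the square to 0 ≤ x + y ≤ 2k + 2, -1 ≤ x - y ≤ 2k + 1, its place in
    -- the definition of H₃ᵏ.
    open Embedding a b c e (k ℤ.- α) (-[1+ 0 ] ℤ.- α ℤ.- k)

    private
      ab ac ae bc be ce κ α′ x y : Expr 10
      ab = var (# 0)
      ac = var (# 1)
      ae = var (# 2)
      bc = var (# 3)
      be = var (# 4)
      ce = var (# 5)
      κ  = var (# 6)
      α′ = var (# 7)
      x  = var (# 8)
      y  = var (# 9)

      ox = κ ⊖ α′
      oy = con -[1+ 0 ] ⊖ α′ ⊖ κ

      A′ B′ C′ E′ z : Point 10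
      A′ = ox , oy
      B′ = ox ⊕ ab , oy ⊕ ac ⊖ bc
      C′ = ox ⊕ ab ⊕ ce ⊖ be , oy ⊕ ac
      E′ = ox ⊕ ab ⊖ be , oy ⊕ ae
      z  = x , y

      frame : Form 10
      frame = metric ab ac ae bc be ce ∧′ con (+ 0) ≼ κ ∧′
              ac ⊕ be ≈ (κ ⊕ con (+ 1)) ⊕ (κ ⊕ con (+ 1)) ⊕ (ab ⊕ ce) ∧′
              ae ⊕ bc ≈ ab ⊕ ce ∧′ α′ ⊕ α′ ⊕ con (+ 1) ≈ ab ⊕ ae ⊖ be

      fact : (F : Form 10) → valid (frame ⇒ F) ≡ true → ∀ p →
             ⟦ F ⟧ (D a b ∷ D a c ∷ D a e ∷ D b c ∷ D b e ∷ D c e ∷ k ∷ α ∷ proj₁ p ∷ proj₂ p ∷ [])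
      fact F ok p = valid-sound (frame ⇒ F) ok _ (metric-holds a b c e ,′ k≥0 ,′ gap ,′ square ,′ base)

    -- A chain in direction ↑ can start at A except at the right tip, where x - y is too large by
    -- one. There it starts at B, which lies at or beyond that tip by parity. Tips A, B, C, D sit at
    -- the vertices A, E, C, B, so two letters do not match; the three lemmas that follow are the
    -- analogues at the other tips.
    below-↑ : ∀ p → Region k p → (A ↑ p) ⊎ (TipD k p × (B ↑ p))
    below-↑ p (inj₁ h) = inj₁ (fact (coreF κ z ⇒ up A′ z) refl p h)
    below-↑ p (inj₂ (inj₁ h)) = inj₁ (fact (tipAF κ z ⇒ up A′ z) refl p h)
    below-↑ p (inj₂ (inj₂ (inj₁ h))) = inj₁ (fact (tipBF κ z ⇒ up A′ z) refl p h)
    below-↑ p (inj₂ (inj₂ (inj₂ (inj₁ h)))) = inj₁ (fact (tipCF κ z ⇒ up A′ z) refl p h)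
    below-↑ p (inj₂ (inj₂ (inj₂ (inj₂ h)))) = inj₂ (h , fact (tipDF κ z ⇒ up B′ z) refl p h)

    above-↑ : ∀ p → Region k p → (p ↑ C) ⊎ (TipB k p × (p ↑ E))
    above-↑ p (inj₁ h) = inj₁ (fact (coreF κ z ⇒ up z C′) refl p h)
    above-↑ p (inj₂ (inj₁ h)) = inj₁ (fact (tipAF κ z ⇒ up z C′) refl p h)
    above-↑ p (inj₂ (inj₂ (inj₁ h))) = inj₂ (h , fact (tipBF κ z ⇒ up z E′) refl p h)
    above-↑ p (inj₂ (inj₂ (inj₂ (inj₁ h)))) = inj₁ (fact (tipCF κ z ⇒ up z C′) refl p h)
    above-↑ p (inj₂ (inj₂ (inj₂ (inj₂ h)))) = inj₁ (fact (tipDF κ z ⇒ up z C′) refl p h)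

    below-↗ : ∀ p → Region k p → (E ↗ p) ⊎ (TipA k p × (A ↗ p))
    below-↗ p (inj₁ h) = inj₁ (fact (coreF κ z ⇒ right E′ z) refl p h)
    below-↗ p (inj₂ (inj₁ h)) = inj₂ (h , fact (tipAF κ z ⇒ right A′ z) refl p h)
    below-↗ p (inj₂ (inj₂ (inj₁ h))) = inj₁ (fact (tipBF κ z ⇒ right E′ z) refl p h)
    below-↗ p (inj₂ (inj₂ (inj₂ (inj₁ h)))) = inj₁ (fact (tipCF κ z ⇒ right E′ z) refl p h)
    below-↗ p (inj₂ (inj₂ (inj₂ (inj₂ h)))) = inj₁ (fact (tipDF κ z ⇒ right E′ z) refl p h)

    above-↗ : ∀ p → Region k p → (p ↗ B) ⊎ (TipC k p × (p ↗ C))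
    above-↗ p (inj₁ h) = inj₁ (fact (coreF κ z ⇒ right z B′) refl p h)
    above-↗ p (inj₂ (inj₁ h)) = inj₁ (fact (tipAF κ z ⇒ right z B′) refl p h)
    above-↗ p (inj₂ (inj₂ (inj₁ h))) = inj₁ (fact (tipBF κ z ⇒ right z B′) refl p h)
    above-↗ p (inj₂ (inj₂ (inj₂ (inj₁ h)))) = inj₂ (h , fact (tipCF κ z ⇒ right z C′) refl p h)
    above-↗ p (inj₂ (inj₂ (inj₂ (inj₂ h)))) = inj₁ (fact (tipDF κ z ⇒ right z B′) refl p h)

    bc-span : proj₂ C ℤ.- proj₂ B ℤ.≤ D b c
    bc-span = fact (proj₂ C′ ⊖ proj₂ B′ ≼ bc) refl A
    ae-span : proj₂ E ℤ.- proj₂ A ℤ.≤ D a e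
    ae-span = fact (proj₂ E′ ⊖ proj₂ A′ ≼ ae) refl A
    ab-span : proj₁ B ℤ.- proj₁ A ℤ.≤ D a b
    ab-span = fact (proj₁ B′ ⊖ proj₁ A′ ≼ ab) refl A
    ec-span : proj₁ C ℤ.- proj₁ E ℤ.≤ D e c
    ec-span = subst (λ t → proj₁ C ℤ.- proj₁ E ℤ.≤ t) (D-sym c e)
                (fact (proj₁ C′ ⊖ proj₁ E′ ≼ ce) refl A)

    module _ {L} (h : Lipschitz L) (corners⊆L : ∀ {s} → s ∈ corners → s ∈ L) where

      private
        A∈ = corners⊆L (here refl)
        B∈ = corners⊆L (there (here refl))
        C∈ = corners⊆L (there (there (here refl)))
        E∈ = corners⊆L (there (there (there (here refl))))

      isometric-↑ : ∀ {p u q v} → (p , u) ∈ L → (q , v) ∈ L → Region k p → Region k q →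
                    p ↑ q → D u v ≡ + δ p q
      isometric-↑ {p} {u} {q} {v} p∈ q∈ hp hq pq = trans (chain (below-↑ p hp) (above-↑ q hq)) (sym (δ-↑ p q pq))
        where
        chain : (A ↑ p) ⊎ (TipD k p × (B ↑ p)) → (q ↑ C) ⊎ (TipB k q × (q ↑ E)) →
                D u v ≡ proj₂ q ℤ.- proj₂ p
        chain (inj₁ Ap)       (inj₁ qC)       = tight-↑ h {A} {a} {p} {u} {q} {v} {C} {c} A∈ p∈ q∈ C∈ Ap pq qC ac-span
        chain (inj₁ Ap)       (inj₂ (_ , qE)) = tight-↑ h {A} {a} {p} {u} {q} {v} {E} {e} A∈ p∈ q∈ E∈ Ap pq qE ae-span
        chain (inj₂ (_ , Bp)) (inj₁ qC)       = tight-↑ h {B} {b} {p} {u} {q} {v} {C} {c} B∈ p∈ q∈ C∈ Bp pq qC bc-span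
        -- A chain from B to E would be needed, but the right and the left tip are 2k + 3 apart in x
        -- and only 1 in y, so `p ↑ q` fails.
        chain (inj₂ (pD , _)) (inj₂ (qB , _)) = ⊥-elim (1≰0 (lia 5 (λ k x y x′ y′ →
          con (+ 0) ≼ k ⇒ tipDF k (x , y) ⇒ tipBF k (x′ , y′) ⇒ up (x , y) (x′ , y′) ⇒ con (+ 1) ≼ con (+ 0)) refl
          k (proj₁ p) (proj₂ p) (proj₁ q) (proj₂ q) k≥0 pD qB pq))

      isometric-↗ : ∀ {p u q v} → (p , u) ∈ L → (q , v) ∈ L → Region k p → Region k q →
                    p ↗ q → D u v ≡ + δ p q
      isometric-↗ {p} {u} {q} {v} p∈ q∈ hp hq pq = trans (chain (below-↗ p hp) (above-↗ q hq)) (sym (δ-↗ p q pq))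
        where
        chain : (E ↗ p) ⊎ (TipA k p × (A ↗ p)) → (q ↗ B) ⊎ (TipC k q × (q ↗ C)) →
                D u v ≡ proj₁ q ℤ.- proj₁ p
        chain (inj₁ Ep)       (inj₁ qB)       = tight-↗ h {E} {e} {p} {u} {q} {v} {B} {b} E∈ p∈ q∈ B∈ Ep pq qB eb-span
        chain (inj₁ Ep)       (inj₂ (_ , qC)) = tight-↗ h {E} {e} {p} {u} {q} {v} {C} {c} E∈ p∈ q∈ C∈ Ep pq qC ec-span
        chain (inj₂ (_ , Ap)) (inj₁ qB)       = tight-↗ h {A} {a} {p} {u} {q} {v} {B} {b} A∈ p∈ q∈ B∈ Ap pq qB ab-span
        chain (inj₂ (pA , _)) (inj₂ (qC , _)) = ⊥-elim (1≰0 (lia 5 (λ k x y x′ y′ →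
          con (+ 0) ≼ k ⇒ tipAF k (x , y) ⇒ tipCF k (x′ , y′) ⇒ right (x , y) (x′ , y′) ⇒ con (+ 1) ≼ con (+ 0)) refl
          k (proj₁ p) (proj₂ p) (proj₁ q) (proj₂ q) k≥0 pA qC pq))

      isometric : ∀ {p u q v} → (p , u) ∈ L → (q , v) ∈ L → Region k p → Region k q → D u v ≡ + δ p q
      isometric {p} {u} {q} {v} p∈ q∈ hp hq with comparable p q
      ... | inj₁ (inj₁ pq) = isometric-↑ {p} {u} {q} {v} p∈ q∈ hp hq pq
      ... | inj₁ (inj₂ qp) = trans (D-sym u v) (trans (isometric-↑ {q} {v} {p} {u} q∈ p∈ hq hp qp) (cong +_ (δ-sym q p)))
      ... | inj₂ (inj₁ pq) = isometric-↗ {p} {u} {q} {v} p∈ q∈ hp hq pq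
      ... | inj₂ (inj₂ qp) = trans (D-sym u v) (trans (isometric-↗ {q} {v} {p} {u} q∈ p∈ hq hp qp) (cong +_ (δ-sym q p)))

    embed : ∀ ps → (∀ {p} → p ∈ ps → Region k p) →
            ∃ λ (φ : Pt → V) → ∀ {p q} → p ∈ ps → q ∈ ps → d (φ p) (φ q) ≡ δ p q
    embed ps region with extendAll corners-∼ ps
    ... | L , h , L⊇ , hit = evaluate a L , λ {p} {q} p∈ q∈ → ℤₚ.+-injective
          (isometric (lipschitz h) L⊇ {p} {evaluate a L p} {q} {evaluate a L q}
            (evaluate-∈ a L (proj₂ (hit p∈))) (evaluate-∈ a L (proj₂ (hit q∈))) (region p∈) (region q∈))

  -- Stated for the metric of the plane and any finite list of points of the region; that shortest
  -- paths inside H₃ᵏ realise this metric is a separate matter.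
  ContainsH₃ : ℕ → Set
  ContainsH₃ k = ∀ ps → (∀ {p} → p ∈ ps → Region (+ k) p) →
    ∃ λ (φ : Pt → V) → ∀ {p q} → p ∈ ps → q ∈ ps → d (φ p) (φ q) ≡ δ p q

  trivial-slice : V → Slice (+ 0)
  trivial-slice v = slice {v} {v} {v} {v} (+ 0) (+ 0) (+ 0) v≤0 v≤0 v≤0 v≤0 (+≤+ z≤n) (+≤+ z≤n)
    where
    v≤0 : D v v ℤ.≤ + 0
    v≤0 = ℤₚ.≤-reflexive (cong +_ (d-refl v))

  -- With a at the origin, r is the value of x + y at E and -g the value of x - y at C, so the
  -- parities of g and r tell which corners of the square are lattice points.
  dichotomy : ∀ a b c e g → D a c ℤ.+ D b e ≡ + g ℤ.+ (D a b ℤ.+ D c e) →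
    D a e ℤ.+ D b c ℤ.≤ D a b ℤ.+ D c e → Slice (+ g) ⊎ ∃ λ k → g ≡ suc (suc (k ℕ.+ k)) × ContainsH₃ k
  dichotomy a b c e g gap order = split (half g) (half ∣ r ∣)
    where
    r = D a b ℤ.+ D a e ℤ.- D b e
    r≡ : + ∣ r ∣ ≡ r
    r≡ = ℤₚ.0≤i⇒+∣i∣≡i (lia 3 (λ ab ae be → be ≼ ab ⊕ ae ⇒ con (+ 0) ≼ ab ⊕ ae ⊖ be) refl
           (D a b) (D a e) (D b e) (proj₂ (proj₂ (triangles a b e))))
    even : ∀ {n} m → n ≡ m ℕ.+ m → + n ≡ + m ℤ.+ + m
    even m = cong +_
    odd : ∀ {n} m → n ≡ suc (m ℕ.+ m) → + n ≡ + m ℤ.+ + m ℤ.+ + 1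
    odd m p = cong +_ (trans p (ℕₚ.+-comm 1 (m ℕ.+ m)))
    gap′ : ∀ {z} → + g ≡ z → D a c ℤ.+ D b e ≡ z ℤ.+ (D a b ℤ.+ D c e)
    gap′ p = trans gap (cong (λ t → t ℤ.+ (D a b ℤ.+ D c e)) p)
    split : (∃ λ m → (g ≡ m ℕ.+ m) ⊎ (g ≡ suc (m ℕ.+ m))) →
            (∃ λ α → (∣ r ∣ ≡ α ℕ.+ α) ⊎ (∣ r ∣ ≡ suc (α ℕ.+ α))) →
            Slice (+ g) ⊎ ∃ λ k → g ≡ suc (suc (k ℕ.+ k)) × ContainsH₃ k
    split (m , inj₁ p) (α , inj₁ q) = inj₁ (subst Slice (sym (even m p))
      (even-slice a b c e (+ m) (+ α) (+ 0) (+≤+ z≤n) (gap′ (even m p))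
        (trans (sym (even α q)) (trans r≡ (sym (ℤₚ.+-identityˡ r)))) (+≤+ z≤n)
        (lia 2 (λ s t → s ≼ t ⇒ con (+ 0) ≼ t ⊖ s) refl (D a e ℤ.+ D b c) (D a b ℤ.+ D c e) order)))
    split (m , inj₁ p) (α , inj₂ q) with D a b ℤ.+ D c e ℤ.≤? D a e ℤ.+ D b c
    -- The rectangle has room for moving the square by one in x + y, which corrects the parity.
    ... | no ≰ = inj₁ (subst Slice (sym (even m p))
      (even-slice a b c e (+ m) (+ α ℤ.+ + 1) (+ 1) (+≤+ z≤n) (gap′ (even m p))
        (lia 2 (λ α r → r ≈ α ⊕ α ⊕ con (+ 1) ⇒ (α ⊕ con (+ 1)) ⊕ (α ⊕ con (+ 1)) ≈ con (+ 1) ⊕ r) refl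
          (+ α) r (trans (sym r≡) (odd α q))) (+≤+ z≤n)
        (lia 2 (λ s t → con (+ 1) ⊕ s ≼ t ⇒ con (+ 1) ≼ t ⊖ s) refl (D a e ℤ.+ D b c) (D a b ℤ.+ D c e)
          (ℤₚ.i<j⇒suc[i]≤j (ℤₚ.≰⇒> ≰)))))
    split (zero , inj₁ p) (α , inj₂ q) | yes ≤ = inj₁ (subst (λ n → Slice (+ n)) (sym p) (trivial-slice a))
    split (suc k , inj₁ p) (α , inj₂ q) | yes ≤ = inj₂ (k , trans p (cong suc (ℕₚ.+-suc k k)) ,
      Extremal.embed a b c e (+ k) (+ α) (+≤+ z≤n) (gap′ (even (k ℕ.+ 1) (trans p (cong (λ i → i ℕ.+ i) (ℕₚ.+-comm 1 k)))))
        (ℤₚ.≤-antisym order ≤) (trans (sym (odd α q)) r≡))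
    split (m , inj₂ p) (α , inj₁ q) = inj₁ (subst Slice (sym (odd m p))
      (odd-slice a b c e (+ m) (+ α) (+≤+ z≤n) (gap′ (odd m p)) (trans (sym (even α q)) r≡) order))
    split (m , inj₂ p) (α , inj₂ q) = inj₁ (subst Slice (sym (odd m p))
      -- Exchanging a with e and b with c replaces r by `D c e` + `D a e` - `D a c`. This equals 2
      -- `D a e` - g - r, so it is even when g and r are odd, and the given witness is its half.
      (odd-slice e c b a (+ m) (D a e ℤ.- + m ℤ.- + α ℤ.- + 1) (+≤+ z≤n)
        (trans (cong₂ ℤ._+_ (D-sym e b) (D-sym c a)) (trans (ℤₚ.+-comm (D b e) (D a c)) (trans (gap′ (odd m p))
          (cong (λ t → + m ℤ.+ + m ℤ.+ + 1 ℤ.+ t) (sym swapped)))))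
        (trans (lia 8 (λ ab ac ae be ce α m r → ac ⊕ be ≈ m ⊕ m ⊕ con (+ 1) ⊕ (ab ⊕ ce) ⇒
            ab ⊕ ae ⊖ be ≈ α ⊕ α ⊕ con (+ 1) ⇒
            (ae ⊖ m ⊖ α ⊖ con (+ 1)) ⊕ (ae ⊖ m ⊖ α ⊖ con (+ 1)) ≈ ce ⊕ ae ⊖ ac) refl
            (D a b) (D a c) (D a e) (D b e) (D c e) (+ α) (+ m) r (gap′ (odd m p)) (trans (sym r≡) (odd α q)))
          (cong₂ ℤ._-_ (cong₂ ℤ._+_ (D-sym c e) (D-sym a e)) (D-sym a c)))
        (subst₂ ℤ._≤_ (cong₂ ℤ._+_ (D-sym a e) (D-sym b c)) (sym swapped) order)))
      where
      swapped : D e c ℤ.+ D b a ≡ D a b ℤ.+ D c e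
      swapped = trans (cong₂ ℤ._+_ (D-sym e c) (D-sym b a)) (ℤₚ.+-comm (D c e) (D a b))

-- Distances in H₃ᵏ

eqPt-sound : ∀ p q → T (eqPt p q) → p ≡ q
eqPt-sound (x , y) (x′ , y′) h with to (T-∧ {eqℤ x x′} {eqℤ y y′}) h
... | a , b = cong₂ _,_ (toWitness {a? = x ℤ.≟ x′} a) (toWitness {a? = y ℤ.≟ y′} b)

eqPt-refl : ∀ p → T (eqPt p p)
eqPt-refl (x , y) = from (T-∧ {eqℤ x x} {eqℤ y y})
  (fromWitness {a? = x ℤ.≟ x} refl , fromWitness {a? = y ℤ.≟ y} refl)

2k+c : ∀ k c → + (2 ℕ.* k ℕ.+ c) ≡ + k ℤ.+ + k ℤ.+ + c
2k+c k c = cong (λ i → + (k ℕ.+ i ℕ.+ c)) (ℕₚ.+-identityʳ k)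

-[k+1] : ∀ k → ℤ.- (k ℤ.+ + 1) ≡ -[1+ 0 ] ℤ.- k
-[k+1] = solve-∀

private
  pair : ∀ {x y x′ y′ : ℤ} → (x , y) ≡ (x′ , y′) → (x ≡ x′) × (y ≡ y′)
  pair refl = refl , refl

inH3⇒region : ∀ k p → T (inH3 k p) → Region (+ k) p
inH3⇒region k p@(x , y) h with to T-∨ h
... | inj₁ c with to T-∧ c
...   | c₁ , c₂ with to T-∧ c₂
...     | c₃ , c₄ with to T-∧ c₄
...       | c₅ , c₆ = inj₁ ((ℤₚ.≤ᵇ⇒≤ c₁ , subst (x ℤ.+ y ℤ.≤_) (2k+c k 2) (ℤₚ.≤ᵇ⇒≤ c₃)) ,
                            (ℤₚ.≤ᵇ⇒≤ c₅ , subst (x ℤ.- y ℤ.≤_) (2k+c k 1) (ℤₚ.≤ᵇ⇒≤ c₆)))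
inH3⇒region k p@(x , y) h | inj₂ r with to (T-∨ {eqPt p (ι k , ℤ.- (ι k ℤ.+ + 1))}) r
... | inj₁ a = let e , f = pair (eqPt-sound p _ a) in inj₂ (inj₁ (e , trans f (-[k+1] (+ k))))
... | inj₂ r₁ with to (T-∨ {eqPt p (ℤ.- (+ 1) , + 1)}) r₁
...   | inj₁ b = inj₂ (inj₂ (inj₁ (pair (eqPt-sound p _ b))))
...   | inj₂ r₂ with to (T-∨ {eqPt p (ι k ℤ.+ + 1 , ι k ℤ.+ + 2)}) r₂
...     | inj₁ c = inj₂ (inj₂ (inj₂ (inj₁ (pair (eqPt-sound p _ c)))))
...     | inj₂ d = let e , f = pair (eqPt-sound p _ d) in
                   inj₂ (inj₂ (inj₂ (inj₂ (trans e (2k+c k 2) , f))))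

region⇒inH3 : ∀ k p → Region (+ k) p → T (inH3 k p)
region⇒inH3 k p@(x , y) (inj₁ ((c₁ , c₂) , (c₃ , c₄))) = from T-∨ (inj₁ (from T-∧ (ℤₚ.≤⇒≤ᵇ c₁ , from T-∧
  (ℤₚ.≤⇒≤ᵇ (subst (x ℤ.+ y ℤ.≤_) (sym (2k+c k 2)) c₂) , from T-∧
  (ℤₚ.≤⇒≤ᵇ c₃ , ℤₚ.≤⇒≤ᵇ (subst (x ℤ.- y ℤ.≤_) (sym (2k+c k 1)) c₄))))))
region⇒inH3 k p@(x , y) (inj₂ h) = from (T-∨ {(+ 0 ℤ.≤ᵇ sP p) ∧ _}) (inj₂ (tips h))
  where
  same : ∀ {x y x′ y′} → x ≡ x′ → y ≡ y′ → T (eqPt (x , y) (x′ , y′))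
  same {x} {y} refl refl = eqPt-refl (x , y)
  tips : TipA (+ k) p ⊎ TipB (+ k) p ⊎ TipC (+ k) p ⊎ TipD (+ k) p → _
  tips (inj₁ (e , f)) = from T-∨ (inj₁ (same e (trans f (sym (-[k+1] (+ k))))))
  tips (inj₂ (inj₁ (e , f))) = from (T-∨ {eqPt p (ι k , ℤ.- (ι k ℤ.+ + 1))}) (inj₂
    (from T-∨ (inj₁ (same e f))))
  tips (inj₂ (inj₂ (inj₁ (e , f)))) = from (T-∨ {eqPt p (ι k , ℤ.- (ι k ℤ.+ + 1))}) (inj₂
    (from (T-∨ {eqPt p (ℤ.- (+ 1) , + 1)}) (inj₂ (from T-∨ (inj₁ (same e f))))))
  tips (inj₂ (inj₂ (inj₂ (e , f)))) = from (T-∨ {eqPt p (ι k , ℤ.- (ι k ℤ.+ + 1))}) (inj₂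
    (from (T-∨ {eqPt p (ℤ.- (+ 1) , + 1)}) (inj₂ (from (T-∨ {eqPt p (ι k ℤ.+ + 1 , ι k ℤ.+ + 2)}) (inj₂
    (same (trans e (sym (2k+c k 2))) f))))))

∈-range : ∀ z a len → a ℤ.≤ z → z ℤ.+ + 1 ℤ.≤ a ℤ.+ + len → z ∈ range a len
∈-range z a len lo hi = subst (_∈ range a len) (trans (cong (ℤ._+_ a) i≡) (lia 2 (λ a z → a ⊕ (z ⊖ a) ≈ z) refl a z))
    (∈-map⁺ (λ i → a ℤ.+ + i) (∈-upTo⁺ (ℤₚ.drop‿+≤+ (subst (λ j → + 1 ℤ.+ j ℤ.≤ + len) (sym i≡)
      (lia 3 (λ a z l → z ⊕ con (+ 1) ≼ a ⊕ l ⇒ con (+ 1) ⊕ (z ⊖ a) ≼ l) refl a z (+ len) hi)))))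
  where
  i≡ : + ∣ z ℤ.- a ∣ ≡ z ℤ.- a
  i≡ = ℤₚ.0≤i⇒+∣i∣≡i (ℤₚ.i≤j⇒0≤j-i lo)

region⇒box : ∀ k p → Region (+ k) p → p ∈ box k
region⇒box k (x , y) h = ∈-concatMap⁺ _ (lose
    (∈-range x (ℤ.- (+ 1)) (2 ℕ.* k ℕ.+ 4) (proj₁ bounds) (subst (λ i → x ℤ.+ + 1 ℤ.≤ -[1+ 0 ] ℤ.+ i) (sym (2k+c k 4)) (proj₁ (proj₂ bounds))))
    (∈-map⁺ (x ,_) (∈-range y (ℤ.- (ι k ℤ.+ + 1)) (2 ℕ.* k ℕ.+ 4)
      (subst (ℤ._≤ y) (sym (-[k+1] (+ k))) (proj₁ (proj₂ (proj₂ bounds))))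
      (subst₂ (λ i j → y ℤ.+ + 1 ℤ.≤ i ℤ.+ j) (sym (-[k+1] (+ k))) (sym (2k+c k 4)) (proj₂ (proj₂ (proj₂ bounds)))))))
  where
  bounds = lia 3 (λ k x y → con (+ 0) ≼ k ⇒ regionF k (x , y) ⇒
      con -[1+ 0 ] ≼ x ∧′ x ⊕ con (+ 1) ≼ con -[1+ 0 ] ⊕ (k ⊕ k ⊕ con (+ 4)) ∧′
      con -[1+ 0 ] ⊖ k ≼ y ∧′ y ⊕ con (+ 1) ≼ (con -[1+ 0 ] ⊖ k) ⊕ (k ⊕ k ⊕ con (+ 4)))
    refl (+ k) x y (+≤+ z≤n) h

region⇒∈ : ∀ k p → Region (+ k) p → p ∈ H3verts k
region⇒∈ k p h = ∈-filter⁺ (λ u → T? (inH3 k u)) (region⇒box k p h) (region⇒inH3 k p h)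

∈⇒region : ∀ k p → p ∈ H3verts k → Region (+ k) p
∈⇒region k p h = inH3⇒region k p (proj₂ (∈-filter⁻ (λ u → T? (inH3 k u)) {xs = box k} h))

↑-trans : ∀ {p q r} → p ↑ q → q ↑ r → p ↑ r
↑-trans {x , y} {x′ , y′} {x″ , y″} (a , b) (c , e) = lia 6 (λ x y x′ y′ x″ y″ →
  up (x , y) (x′ , y′) ⇒ up (x′ , y′) (x″ , y″) ⇒ up (x , y) (x″ , y″)) refl x y x′ y′ x″ y″ (a , b) (c , e)

δ-additive-↑ : ∀ {p q r} → p ↑ q → q ↑ r → δ p q ℕ.+ δ q r ≡ δ p r
δ-additive-↑ {p} {q} {r} a b = ℤₚ.+-injective (trans (cong₂ ℤ._+_ (δ-↑ p q a) (δ-↑ q r b))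
  (trans (lia 3 (λ x y z → (y ⊖ x) ⊕ (z ⊖ y) ≈ z ⊖ x) refl (proj₂ p) (proj₂ q) (proj₂ r))
    (sym (δ-↑ p r (↑-trans {p} {q} {r} a b)))))

-- The rotation of H₃ᵏ by a quarter turn: D ↦ A, A ↦ B, B ↦ C, C ↦ D.
rotate : ℤ → Pt → Pt
rotate k (x , y) = y ℤ.+ k , k ℤ.+ + 1 ℤ.- x

rotateF : ∀ {n} → Expr n → Point n → Point n
rotateF k (x , y) = y ⊕ k , k ⊕ con (+ 1) ⊖ x

rotate-region : ∀ k p → Region k p → Region k (rotate k p)
rotate-region k (x , y) (inj₁ h) = inj₁ (lia 3 (λ k x y →
  coreF k (x , y) ⇒ coreF k (rotateF k (x , y))) refl k x y h)
rotate-region k (x , y) (inj₂ (inj₁ h)) = inj₂ (inj₂ (inj₁ (lia 3 (λ k x y →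
  tipAF k (x , y) ⇒ tipBF k (rotateF k (x , y))) refl k x y h)))
rotate-region k (x , y) (inj₂ (inj₂ (inj₁ h))) = inj₂ (inj₂ (inj₂ (inj₁ (lia 3 (λ k x y →
  tipBF k (x , y) ⇒ tipCF k (rotateF k (x , y))) refl k x y h))))
rotate-region k (x , y) (inj₂ (inj₂ (inj₂ (inj₁ h)))) = inj₂ (inj₂ (inj₂ (inj₂ (lia 3 (λ k x y →
  tipCF k (x , y) ⇒ tipDF k (rotateF k (x , y))) refl k x y h))))
rotate-region k (x , y) (inj₂ (inj₂ (inj₂ (inj₂ h)))) = inj₂ (inj₁ (lia 3 (λ k x y →
  tipDF k (x , y) ⇒ tipAF k (rotateF k (x , y))) refl k x y h))

δ-rotate : ∀ k p q → δ (rotate k p) (rotate k q) ≡ δ p q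
δ-rotate k (x , y) (x′ , y′) = trans
  (cong₂ (λ i j → ∣ i ∣ ℕ.⊔ ∣ j ∣)
    (lia 3 (λ k y y′ → (y ⊕ k) ⊖ (y′ ⊕ k) ≈ y ⊖ y′) refl k y y′)
    (lia 3 (λ k x x′ → (k ⊕ con (+ 1) ⊖ x) ⊖ (k ⊕ con (+ 1) ⊖ x′) ≈ x′ ⊖ x) refl k x x′))
  (trans (ℕₚ.⊔-comm ∣ y ℤ.- y′ ∣ ∣ x′ ℤ.- x ∣) (cong (ℕ._⊔ ∣ y ℤ.- y′ ∣) (ℤₚ.∣i-j∣≡∣j-i∣ x′ x)))

rotate³ : ℤ → Pt → Pt
rotate³ k p = rotate k (rotate k (rotate k p))

rotate-rotate³ : ∀ k p → rotate k (rotate³ k p) ≡ p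
rotate-rotate³ k (x , y) = cong₂ _,_
  (lia 3 (λ k x y → proj₁ (rotateF k (rotateF k (rotateF k (rotateF k (x , y))))) ≈ x) refl k x y)
  (lia 3 (λ k x y → proj₂ (rotateF k (rotateF k (rotateF k (rotateF k (x , y))))) ≈ y) refl k x y)

rotate³-↗ : ∀ k p q → p ↗ q → rotate³ k p ↑ rotate³ k q
rotate³-↗ k (x , y) (x′ , y′) h = lia 5 (λ k x y x′ y′ → right (x , y) (x′ , y′) ⇒
  up (rotateF k (rotateF k (rotateF k (x , y)))) (rotateF k (rotateF k (rotateF k (x′ , y′)))))
  refl k x y x′ y′ h

module H₃-distance (k : ℕ) where

  private
    K = + k
    K≥0 : + 0 ℤ.≤ K
    K≥0 = +≤+ z≤n

  open DistProperties (H3verts k) kingAdj eqPt eqPt-refl eqPt-sound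

  adjacent⇒ : ∀ p q → T (kingAdj p q) → δ p q ≡ 1
  adjacent⇒ p q = ℕₚ.≡ᵇ⇒≡ (δ p q) 1

  ⇒adjacent : ∀ p q → δ p q ≡ 1 → T (kingAdj p q)
  ⇒adjacent p q = ℕₚ.≡⇒≡ᵇ (δ p q) 1

  kingAdj-sym : ∀ p q → T (kingAdj p q) → T (kingAdj q p)
  kingAdj-sym p q h = ⇒adjacent q p (trans (δ-sym q p) (adjacent⇒ p q h))

  ball⇒δ≤ : ∀ m {p q} → Ball m p q → δ p q ℕ.≤ m
  ball⇒δ≤ zero {p} h rewrite sym (ball-zero h) = ℕₚ.≤-reflexive (δ-refl p)
  ball⇒δ≤ (suc m) {p} {q} h with ball-suc⁻ h
  ... | inj₁ h′ = ℕₚ.m≤n⇒m≤1+n (ball⇒δ≤ m h′)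
  ... | inj₂ (w , _ , h′ , a) = ℕₚ.≤-trans (δ-tri p w q)
    (subst (δ p w ℕ.+ δ w q ℕ.≤_) (ℕₚ.+-comm m 1) (ℕₚ.+-mono-≤ (ball⇒δ≤ m h′) (ℕₚ.≤-reflexive (adjacent⇒ w q a))))

  Geodesic : Pt → Pt → Set
  Geodesic p q = Ball (δ p q) p q

  geodesic-refl : ∀ {p q} → proj₁ p ≡ proj₁ q → proj₂ p ≡ proj₂ q → Geodesic p q
  geodesic-refl {p} refl refl = subst (λ m → Ball m p p) (sym (δ-refl p)) (ball-refl p)

  geodesic-sym : ∀ {p q} → Region K q → Geodesic p q → Geodesic q p
  geodesic-sym {p} {q} hq h = subst (λ m → Ball m q p) (δ-sym p q)
    (ball-sym kingAdj-sym (δ p q) (region⇒∈ k q hq) h)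

  geodesic-↑ : ∀ {p q r} → p ↑ q → q ↑ r → Geodesic p q → Geodesic q r → Geodesic p r
  geodesic-↑ {p} {q} {r} a b g h = subst (λ m → Ball m p r) (δ-additive-↑ {p} {q} {r} a b) (ball-trans g h)

  edge-↑ : ∀ {p q} → Region K p → p ↑ q → proj₂ q ≡ proj₂ p ℤ.+ + 1 → Geodesic p q
  edge-↑ {p} {q} hp a e = subst (λ m → Ball m p q) (sym one)
      (ball-step (region⇒∈ k p hp) (ball-refl p) (⇒adjacent p q one))
    where
    one : δ p q ≡ 1
    one = ℤₚ.+-injective (trans (δ-↑ p q a)
      (lia 2 (λ y y′ → y′ ≈ y ⊕ con (+ 1) ⇒ y′ ⊖ y ≈ con (+ 1)) refl (proj₂ p) (proj₂ q) e))

  -- The upward step is vertical if x + y and x - y both differ at p and q. If one of them agrees,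
  -- parity makes the other differ by at least two, and the diagonal step that preserves the first
  -- fits.
  core-geodesic : ∀ m {p q} → Core K p → Core K q → p ↑ q → proj₂ q ≡ proj₂ p ℤ.+ + m → Geodesic p q
  core-geodesic zero {x , y} {x′ , y′} hp hq a e = geodesic-refl
    (lia 4 (λ x y x′ y′ → up (x , y) (x′ , y′) ⇒ y′ ≈ y ⊕ con (+ 0) ⇒ x ≈ x′) refl x y x′ y′ a e)
    (lia 2 (λ y y′ → y′ ≈ y ⊕ con (+ 0) ⇒ y ≈ y′) refl y y′ e)
  core-geodesic (suc m) {p@(x , y)} {q@(x′ , y′)} hp hq a e = split next
    where
    next = lia 6 (λ K x y x′ y′ m →
      let p = x , y
          q = x′ , y′
          n₁ = x , y ⊕ con (+ 1)
          n₂ = x ⊖ con (+ 1) , y ⊕ con (+ 1)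
          n₃ = x ⊕ con (+ 1) , y ⊕ con (+ 1)
      in coreF K p ⇒ coreF K q ⇒ up p q ⇒ y′ ≈ y ⊕ (con (+ 1) ⊕ m) ⇒ con (+ 0) ≼ m ⇒
         (coreF K n₁ ∧′ up n₁ q) ∨′ (coreF K n₂ ∧′ up n₂ q) ∨′ (coreF K n₃ ∧′ up n₃ q))
      refl K x y x′ y′ (+ m) hp hq a e (+≤+ z≤n)
    continue : ∀ x″ → p ↑ (x″ , y ℤ.+ + 1) → Core K (x″ , y ℤ.+ + 1) → (x″ , y ℤ.+ + 1) ↑ q → Geodesic p q
    continue x″ b hn c = geodesic-↑ {p} {x″ , y ℤ.+ + 1} {q} b c (edge-↑ (inj₁ hp) b refl)
      (core-geodesic m hn hq c
        (lia 3 (λ y y′ m → y′ ≈ y ⊕ (con (+ 1) ⊕ m) ⇒ y′ ≈ y ⊕ con (+ 1) ⊕ m) refl y y′ (+ m) e))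
    split : _ → Geodesic p q
    split (inj₁ (hn , c))        = continue x
      (lia 2 (λ x y → up (x , y) (x , y ⊕ con (+ 1))) refl x y) hn c
    split (inj₂ (inj₁ (hn , c))) = continue (x ℤ.- + 1)
      (lia 2 (λ x y → up (x , y) (x ⊖ con (+ 1) , y ⊕ con (+ 1))) refl x y) hn c
    split (inj₂ (inj₂ (hn , c))) = continue (x ℤ.+ + 1)
      (lia 2 (λ x y → up (x , y) (x ⊕ con (+ 1) , y ⊕ con (+ 1))) refl x y) hn c

  core-geodesic-↑ : ∀ p q → Core K p → Core K q → p ↑ q → Geodesic p q
  core-geodesic-↑ p q hp hq a = core-geodesic (δ p q) hp hq a
    (lia 3 (λ y y′ m → m ≈ y′ ⊖ y ⇒ y′ ≈ y ⊕ m) refl (proj₂ p) (proj₂ q) (+ δ p q) (δ-↑ p q a))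

  private
    Entry Exit : Pt → Pt → Set
    Entry p q = ∃ λ n → Core K n × (p ↑ n) × (proj₂ n ≡ proj₂ p ℤ.+ + 1) × (n ↑ q)
    Exit p q = ∃ λ n → Core K n × (p ↑ n) × (proj₂ q ≡ proj₂ n ℤ.+ + 1) × (n ↑ q)

  -- Among the tips only the left and the top one can lie above a core point. The top one has two
  -- neighbours to come from: on the edge x - y = -1 of the core only the left of them is above p.
  exit : ∀ p q → Core K p → Region K q → p ↑ q → Core K q ⊎ Exit p q
  exit p q hp (inj₁ hq) a = inj₁ hq
  exit (x , y) (x′ , y′) hp (inj₂ (inj₁ hq)) a = ⊥-elim (1≰0 (lia 5 (λ K x y x′ y′ → con (+ 0) ≼ K ⇒
    coreF K (x , y) ⇒ tipAF K (x′ , y′) ⇒ up (x , y) (x′ , y′) ⇒ con (+ 1) ≼ con (+ 0)) refl K x y x′ y′ K≥0 hp hq a))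
  exit (x , y) (x′ , y′) hp (inj₂ (inj₂ (inj₁ hq))) a = inj₂ ((+ 0 , + 0) ,
    lia 5 (λ K x y x′ y′ → con (+ 0) ≼ K ⇒
      let n = con (+ 0) , con (+ 0) in
      coreF K (x , y) ⇒ tipBF K (x′ , y′) ⇒ up (x , y) (x′ , y′) ⇒
      (coreF K n ∧′ up (x , y) n ∧′ y′ ≈ proj₂ n ⊕ con (+ 1) ∧′ up n (x′ , y′))) refl K x y x′ y′ K≥0 hp hq a)
  exit (x , y) (x′ , y′) hp (inj₂ (inj₂ (inj₂ (inj₁ hq)))) a = inj₂ (choose
    (lia 5 (λ K x y x′ y′ → con (+ 0) ≼ K ⇒
      let n₁ = K ⊕ con (+ 1) , K ⊕ con (+ 1)
          n₂ = K , K ⊕ con (+ 1)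
          good = λ n → coreF K n ∧′ up (x , y) n ∧′ y′ ≈ proj₂ n ⊕ con (+ 1) ∧′ up n (x′ , y′)
      in coreF K (x , y) ⇒ tipCF K (x′ , y′) ⇒ up (x , y) (x′ , y′) ⇒ (good n₁ ∨′ good n₂))
      refl K x y x′ y′ K≥0 hp hq a))
    where
    choose : _ ⊎ _ → Exit (x , y) (x′ , y′)
    choose (inj₁ h) = (K ℤ.+ + 1 , K ℤ.+ + 1) , h
    choose (inj₂ h) = (K , K ℤ.+ + 1) , h
  exit (x , y) (x′ , y′) hp (inj₂ (inj₂ (inj₂ (inj₂ hq)))) a = ⊥-elim (1≰0 (lia 5 (λ K x y x′ y′ → con (+ 0) ≼ K ⇒
    coreF K (x , y) ⇒ tipDF K (x′ , y′) ⇒ up (x , y) (x′ , y′) ⇒ con (+ 1) ≼ con (+ 0)) refl K x y x′ y′ K≥0 hp hq a))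

  entry : ∀ p q → Region K p → Region K q → p ↑ q →
          ((proj₁ p ≡ proj₁ q) × (proj₂ p ≡ proj₂ q)) ⊎ Core K p ⊎ Entry p q
  entry p q (inj₁ hp) hq a = inj₂ (inj₁ hp)
  entry (x , y) (x′ , y′) (inj₂ (inj₁ hp)) hq a = choose
    (lia 5 (λ K x y x′ y′ → con (+ 0) ≼ K ⇒
      let n₁ = K , con (+ 0) ⊖ K
          n₂ = K ⊕ con (+ 1) , con (+ 0) ⊖ K
          good = λ n → coreF K n ∧′ up (x , y) n ∧′ proj₂ n ≈ y ⊕ con (+ 1) ∧′ up n (x′ , y′)
      in tipAF K (x , y) ⇒ regionF K (x′ , y′) ⇒ up (x , y) (x′ , y′) ⇒ (x ≈ x′ ∧′ y ≈ y′) ∨′ (good n₁ ∨′ good n₂))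
      refl K x y x′ y′ K≥0 hp hq a)
    where
    choose : _ → _
    choose (inj₁ h)        = inj₁ h
    choose (inj₂ (inj₁ h)) = inj₂ (inj₂ ((K , + 0 ℤ.- K) , h))
    choose (inj₂ (inj₂ h)) = inj₂ (inj₂ ((K ℤ.+ + 1 , + 0 ℤ.- K) , h))
  entry (x , y) (x′ , y′) (inj₂ (inj₂ (inj₁ hp))) hq a = inj₁
    (lia 5 (λ K x y x′ y′ → con (+ 0) ≼ K ⇒
      tipBF K (x , y) ⇒ regionF K (x′ , y′) ⇒ up (x , y) (x′ , y′) ⇒ (x ≈ x′ ∧′ y ≈ y′)) refl K x y x′ y′ K≥0 hp hq a)
  entry (x , y) (x′ , y′) (inj₂ (inj₂ (inj₂ (inj₁ hp)))) hq a = inj₁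
    (lia 5 (λ K x y x′ y′ → con (+ 0) ≼ K ⇒
      tipCF K (x , y) ⇒ regionF K (x′ , y′) ⇒ up (x , y) (x′ , y′) ⇒ (x ≈ x′ ∧′ y ≈ y′)) refl K x y x′ y′ K≥0 hp hq a)
  entry (x , y) (x′ , y′) (inj₂ (inj₂ (inj₂ (inj₂ hp)))) hq a = choose
    (lia 5 (λ K x y x′ y′ → con (+ 0) ≼ K ⇒
      let n = K ⊕ K ⊕ con (+ 1) , con (+ 1)
          good = coreF K n ∧′ up (x , y) n ∧′ proj₂ n ≈ y ⊕ con (+ 1) ∧′ up n (x′ , y′)
      in tipDF K (x , y) ⇒ regionF K (x′ , y′) ⇒ up (x , y) (x′ , y′) ⇒ (x ≈ x′ ∧′ y ≈ y′) ∨′ good)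
      refl K x y x′ y′ K≥0 hp hq a)
    where
    choose : _ → _
    choose (inj₁ h) = inj₁ h
    choose (inj₂ h) = inj₂ (inj₂ ((K ℤ.+ K ℤ.+ + 1 , + 1) , h))

  from-core-↑ : ∀ p q → Core K p → Region K q → p ↑ q → Geodesic p q
  from-core-↑ p q hp hq a with exit p q hp hq a
  ... | inj₁ hq′ = core-geodesic-↑ p q hp hq′ a
  ... | inj₂ (n , hn , b , e , c) =
    geodesic-↑ {p} {n} {q} b c (core-geodesic-↑ p n hp hn b) (edge-↑ (inj₁ hn) c e)

  region-geodesic-↑ : ∀ p q → Region K p → Region K q → p ↑ q → Geodesic p q
  region-geodesic-↑ p q hp hq a with entry p q hp hq a
  ... | inj₁ (e , f)  = geodesic-refl e f
  ... | inj₂ (inj₁ h) = from-core-↑ p q h hq a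
  ... | inj₂ (inj₂ (n , hn , b , e , c)) =
    geodesic-↑ {p} {n} {q} b c (edge-↑ hp b e) (from-core-↑ n q hn hq c)

  ball-rotate : ∀ m {p q} → Ball m p q → Ball m (rotate K p) (rotate K q)
  ball-rotate zero {p} h rewrite ball-zero h = ball-refl _
  ball-rotate (suc m) {p} {q} h with ball-suc⁻ h
  ... | inj₁ h′ = ball-suc (ball-rotate m h′)
  ... | inj₂ (w , w∈ , h′ , a) = ball-step (region⇒∈ k _ (rotate-region K w (∈⇒region k w w∈))) (ball-rotate m h′)
          (⇒adjacent (rotate K w) (rotate K q) (trans (δ-rotate K w q) (adjacent⇒ w q a)))

  -- Three quarter turns change ↗ into ↑, and a fourth brings the path back; H₃ᵏ is invariant under
  -- all of them.
  region-geodesic-↗ : ∀ p q → Region K p → Region K q → p ↗ q → Geodesic p q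
  region-geodesic-↗ p q hp hq a = subst₂ Geodesic (rotate-rotate³ K p) (rotate-rotate³ K q)
    (subst (λ m → Ball m (rotate K (rotate³ K p)) (rotate K (rotate³ K q)))
      (sym (δ-rotate K (rotate³ K p) (rotate³ K q)))
      (ball-rotate _ (region-geodesic-↑ (rotate³ K p) (rotate³ K q) (rotate³-region p hp) (rotate³-region q hq)
        (rotate³-↗ K p q a))))
    where
    rotate³-region : ∀ p → Region K p → Region K (rotate³ K p)
    rotate³-region p h = rotate-region K _ (rotate-region K _ (rotate-region K p h))

  geodesic : ∀ p q → Region K p → Region K q → Geodesic p q
  geodesic p q hp hq with comparable p q
  ... | inj₁ (inj₁ a) = region-geodesic-↑ p q hp hq a
  ... | inj₁ (inj₂ a) = geodesic-sym {q} {p} hp (region-geodesic-↑ q p hq hp a)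
  ... | inj₂ (inj₁ a) = region-geodesic-↗ p q hp hq a
  ... | inj₂ (inj₂ a) = geodesic-sym {q} {p} hp (region-geodesic-↗ q p hq hp a)

  dH3≡δ : ∀ p q → p ∈ H3verts k → q ∈ H3verts k → dH3 k p q ≡ δ p q
  dH3≡δ p q p∈ q∈ = ℕₚ.≤-antisym (dist-≤ g) (ball⇒δ≤ (dH3 k p q) (dist-ball q∈ g))
    where g = geodesic p q (∈⇒region k p p∈) (∈⇒region k q q∈)

-- τ and hb

maxOver-∈ : ∀ {A : Set} {xs : List A} (f : A → ℕ) {x} → x ∈ xs → f x ≤ maxOver xs f
maxOver-∈ f {x} (here refl) = ℕₚ.m≤m⊔n (f x) _
maxOver-∈ {xs = y ∷ _} f (there x∈) = ℕₚ.≤-trans (maxOver-∈ f x∈) (ℕₚ.m≤n⊔m (f y) _)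

maxOver-≤ : ∀ {A : Set} (xs : List A) (f : A → ℕ) {m} → (∀ x → f x ≤ m) → maxOver xs f ≤ m
maxOver-≤ [] f h = z≤n
maxOver-≤ (x ∷ xs) f h = ℕₚ.⊔-lub (h x) (maxOver-≤ xs f h)

-- Only positive values are covered, since 0 is also the default of an empty list.
maxOver-attained : ∀ {A : Set} (xs : List A) (f : A → ℕ) {m} → maxOver xs f ≡ suc m → ∃ λ x → f x ≡ suc m
maxOver-attained (x ∷ xs) f h with ℕₚ.⊔-sel (f x) (maxOver xs f)
... | inj₁ e = x , trans (sym e) h
... | inj₂ e = maxOver-attained xs f (trans (sym e) h)

-- The letters of a constructor list the three numbers from the largest to the smallest.
data Ranking (a b c : ℕ) : Set where
  abc : b ≤ a → c ≤ b → topGap a b c ≡ a ℕ.∸ b → Ranking a b c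
  acb : c ≤ a → b ≤ c → topGap a b c ≡ a ℕ.∸ c → Ranking a b c
  bac : a ≤ b → c ≤ a → topGap a b c ≡ b ℕ.∸ a → Ranking a b c
  bca : c ≤ b → a ≤ c → topGap a b c ≡ b ℕ.∸ c → Ranking a b c
  cab : a ≤ c → b ≤ a → topGap a b c ≡ c ℕ.∸ a → Ranking a b c
  cba : b ≤ c → a ≤ b → topGap a b c ≡ c ℕ.∸ b → Ranking a b c

ranking : ∀ a b c → Ranking a b c
ranking a b c with ℕₚ.≤-total b a
ranking a b c | inj₁ b≤a with ℕₚ.≤-total c a
ranking a b c | inj₁ b≤a | inj₂ a≤c = cab a≤c b≤a gap
  where
  gap : topGap a b c ≡ c ℕ.∸ a
  gap rewrite ℕₚ.m≥n⇒m⊔n≡m b≤a | ℕₚ.m≥n⇒m⊓n≡n b≤a | ℕₚ.m≤n⇒m⊔n≡n a≤c | ℕₚ.m≤n⇒m⊓n≡m a≤c | ℕₚ.m≤n⇒m⊔n≡n b≤a = refl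
ranking a b c | inj₁ b≤a | inj₁ c≤a with ℕₚ.≤-total c b
... | inj₁ c≤b = abc b≤a c≤b gap
  where
  gap : topGap a b c ≡ a ℕ.∸ b
  gap rewrite ℕₚ.m≥n⇒m⊔n≡m b≤a | ℕₚ.m≥n⇒m⊓n≡n b≤a | ℕₚ.m≥n⇒m⊔n≡m c≤a | ℕₚ.m≥n⇒m⊓n≡n c≤a | ℕₚ.m≥n⇒m⊔n≡m c≤b = refl
... | inj₂ b≤c = acb c≤a b≤c gap
  where
  gap : topGap a b c ≡ a ℕ.∸ c
  gap rewrite ℕₚ.m≥n⇒m⊔n≡m b≤a | ℕₚ.m≥n⇒m⊓n≡n b≤a | ℕₚ.m≥n⇒m⊔n≡m c≤a | ℕₚ.m≥n⇒m⊓n≡n c≤a | ℕₚ.m≤n⇒m⊔n≡n b≤c = refl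
ranking a b c | inj₂ a≤b with ℕₚ.≤-total c b
ranking a b c | inj₂ a≤b | inj₂ b≤c = cba b≤c a≤b gap
  where
  gap : topGap a b c ≡ c ℕ.∸ b
  gap rewrite ℕₚ.m≤n⇒m⊔n≡n a≤b | ℕₚ.m≤n⇒m⊓n≡m a≤b | ℕₚ.m≤n⇒m⊔n≡n b≤c | ℕₚ.m≤n⇒m⊓n≡m b≤c | ℕₚ.m≤n⇒m⊔n≡n a≤b = refl
ranking a b c | inj₂ a≤b | inj₁ c≤b with ℕₚ.≤-total c a
... | inj₁ c≤a = bac a≤b c≤a gap
  where
  gap : topGap a b c ≡ b ℕ.∸ a
  gap rewrite ℕₚ.m≤n⇒m⊔n≡n a≤b | ℕₚ.m≤n⇒m⊓n≡m a≤b | ℕₚ.m≥n⇒m⊔n≡m c≤b | ℕₚ.m≥n⇒m⊓n≡n c≤b | ℕₚ.m≥n⇒m⊔n≡m c≤a = refl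
... | inj₂ a≤c = bca c≤b a≤c gap
  where
  gap : topGap a b c ≡ b ℕ.∸ c
  gap rewrite ℕₚ.m≤n⇒m⊔n≡n a≤b | ℕₚ.m≤n⇒m⊓n≡m a≤b | ℕₚ.m≥n⇒m⊔n≡m c≤b | ℕₚ.m≥n⇒m⊓n≡n c≤b | ℕₚ.m≤n⇒m⊔n≡n a≤c = refl

topGap-+ : ∀ s t → topGap (s ℕ.+ t) s s ≡ t
topGap-+ s t rewrite ℕₚ.m≥n⇒m⊔n≡m (ℕₚ.m≤m+n s t) | ℕₚ.m≥n⇒m⊓n≡n (ℕₚ.m≤m+n s t) | ℕₚ.m≥n⇒m⊔n≡m (ℕₚ.m≤m+n s t)
  | ℕₚ.⊔-idem s = ℕₚ.m+n∸m≡n s t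

tipA tipB tipC tipD : ℤ → Pt
tipA k = k , -[1+ 0 ] ℤ.- k
tipB k = -[1+ 0 ] , + 1
tipC k = k ℤ.+ + 1 , k ℤ.+ + 2
tipD k = k ℤ.+ k ℤ.+ + 2 , + 0

tipAE tipBE tipCE tipDE : ∀ {n} → Expr n → Point n
tipAE k = k , con -[1+ 0 ] ⊖ k
tipBE k = con -[1+ 0 ] , con (+ 1)
tipCE k = k ⊕ con (+ 1) , k ⊕ con (+ 2)
tipDE k = k ⊕ k ⊕ con (+ 2) , con (+ 0)

-- Slices, gaps and H₃ᵏ in a Helly graph

module HellyGraph (G : Graph) (helly : Helly G) where

  open GraphMetric G using (d-refl; d-zero; d-sym; d-tri; disks-meet)
  open Helly-space (d G) d-refl d-zero d-sym d-tri (disks-meet helly)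

  private
    vs = allFin (Graph.n G)

  slice⇒≤τ : ∀ {g} → Slice (+ g) → g ≤ τ G
  slice⇒≤τ {g} (x , y , u , v , xuy , xvy , xu≡xv , long) =
    ℕₚ.≤-trans (ℤₚ.drop‿+≤+ long) (ℕₚ.≤-trans (subst (λ b → d G u v ≤ (if b then d G u v else 0)) (sym holds) ℕₚ.≤-refl)
      (ℕₚ.≤-trans (maxOver-∈ _ (∈-allFin v)) (ℕₚ.≤-trans (maxOver-∈ _ (∈-allFin u))
        (ℕₚ.≤-trans (maxOver-∈ _ (∈-allFin y)) (maxOver-∈ _ (∈-allFin x))))))
    where
    test : ∀ {m n} → m ≡ n → T (m ℕ.≡ᵇ n)
    test {m} {n} = ℕₚ.≡⇒≡ᵇ m n
    holds : inI G x y u ∧ inI G x y v ∧ (d G x u ℕ.≡ᵇ d G x v) ≡ true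
    holds = to T-≡ (from T-∧ (test (ℤₚ.+-injective xuy) , from T-∧ (test (ℤₚ.+-injective xvy) , test (ℤₚ.+-injective xu≡xv))))

  τ≤ : ∀ {m} → (∀ x y u v → d G x u ℕ.+ d G u y ≡ d G x y → d G x v ℕ.+ d G v y ≡ d G x y →
        d G x u ≡ d G x v → d G u v ≤ m) → τ G ≤ m
  τ≤ {m} h = maxOver-≤ vs _ λ x → maxOver-≤ vs _ λ y → maxOver-≤ vs _ λ u → maxOver-≤ vs _ λ v → bound x y u v
    where
    bound : ∀ x y u v → (if inI G x y u ∧ inI G x y v ∧ (d G x u ℕ.≡ᵇ d G x v) then d G u v else 0) ≤ m
    bound x y u v with inI G x y u in p | inI G x y v in q | d G x u ℕ.≡ᵇ d G x v in r
    ... | false | _     | _     = z≤n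
    ... | true  | false | _     = z≤n
    ... | true  | true  | false = z≤n
    ... | true  | true  | true  = h x y u v (ℕₚ.≡ᵇ⇒≡ _ _ (from T-≡ p)) (ℕₚ.≡ᵇ⇒≡ _ _ (from T-≡ q)) (ℕₚ.≡ᵇ⇒≡ _ _ (from T-≡ r))

  gap : Vx G → Vx G → Vx G → Vx G → ℕ
  gap u v w x = topGap (d G u v ℕ.+ d G w x) (d G u w ℕ.+ d G v x) (d G u x ℕ.+ d G v w)

  gap≤twoHb : ∀ u v w x → gap u v w x ≤ twoHb G
  gap≤twoHb u v w x = ℕₚ.≤-trans (maxOver-∈ _ (∈-allFin x)) (ℕₚ.≤-trans (maxOver-∈ _ (∈-allFin w))
    (ℕₚ.≤-trans (maxOver-∈ _ (∈-allFin v)) (maxOver-∈ _ (∈-allFin u))))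

  twoHb≤ : ∀ {m} → (∀ u v w x → gap u v w x ≤ m) → twoHb G ≤ m
  twoHb≤ h = maxOver-≤ vs _ λ u → maxOver-≤ vs _ λ v → maxOver-≤ vs _ λ w → maxOver-≤ vs _ λ x → h u v w x

  twoHb-attained : ∀ {m} → twoHb G ≡ suc m → ∃ λ u → ∃ λ v → ∃ λ w → ∃ λ x → gap u v w x ≡ suc m
  twoHb-attained p with maxOver-attained vs _ p
  ... | u , p₁ with maxOver-attained vs _ p₁
  ...   | v , p₂ with maxOver-attained vs _ p₂
  ...     | w , p₃ with maxOver-attained vs _ p₃
  ...       | x , p₄ = u , v , w , x , p₄

  uniform-gap : ∀ {u v w x} s t → d G u v ℕ.+ d G w x ≡ s ℕ.+ t → d G u w ℕ.+ d G v x ≡ s →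
                d G u x ℕ.+ d G v w ≡ s → t ≤ twoHb G
  uniform-gap {u} {v} {w} {x} s t p q r = subst (_≤ twoHb G)
    (trans (cong₂ (λ i f → f i) p (cong₂ (λ i j k → topGap k i j) q r)) (topGap-+ s t)) (gap≤twoHb u v w x)

  -- For x, y and two members u, v of a slice, both sums other than d(x,y) + d(u,v) equal d(x,y), so
  -- the gap is d(u,v).
  τ≤twoHb : τ G ≤ twoHb G
  τ≤twoHb = τ≤ λ x y u v xuy xvy xu≡xv → uniform-gap (d G x y) (d G u v) refl
    (trans (cong₂ ℕ._+_ xu≡xv (d-sym y v)) xvy) (trans (cong₂ ℕ._+_ (sym xu≡xv) (d-sym y u)) xuy)

  Outcome : ℕ → Set
  Outcome g = g ≤ τ G ⊎ ∃ λ k → g ≡ suc (suc (k ℕ.+ k)) × IsometricH3 k G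

  quadruple : ∀ a b c e {S₁ S₂ S₃} → d G a c ℕ.+ d G b e ≡ S₁ → d G a b ℕ.+ d G c e ≡ S₂ →
              d G a e ℕ.+ d G b c ≡ S₃ → S₂ ≤ S₁ → S₃ ≤ S₂ → Outcome (S₁ ℕ.∸ S₂)
  quadruple a b c e refl refl refl h₁ h₂
    with dichotomy a b c e _ (cong +_ (sym (ℕₚ.m∸n+n≡m h₁))) (+≤+ h₂)
  ... | inj₁ s = inj₁ (slice⇒≤τ s)
  ... | inj₂ (k , e≡ , contains) = inj₂ (k , e≡ , φ , λ {p} {q} p∈ q∈ →
          trans (isometric p∈ q∈) (sym (H₃-distance.dH3≡δ k p q p∈ q∈)))
    where
    embedding = contains (H3verts k) (λ {p} → ∈⇒region k p)
    φ = proj₁ embedding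
    isometric = proj₂ embedding

  outcome : ∀ u v w x → Outcome (gap u v w x)
  outcome u v w x with ranking (d G u v ℕ.+ d G w x) (d G u w ℕ.+ d G v x) (d G u x ℕ.+ d G v w)
  -- In all six cases the vertices are renamed so that the largest sum is ac + be and the second is
  -- ab + ce.
  ... | abc p q e rewrite e = quadruple u w v x refl refl (cong (d G u x ℕ.+_) (d-sym w v)) p q
  ... | acb p q e rewrite e = quadruple u x v w (cong (d G u v ℕ.+_) (d-sym x w)) refl (cong (d G u w ℕ.+_) (d-sym x v)) p q
  ... | bac p q e rewrite e = quadruple u v w x refl refl refl p q
  ... | bca p q e rewrite e = quadruple u x w v (cong (d G u w ℕ.+_) (d-sym x v)) (cong (d G u x ℕ.+_) (d-sym w v))
                                (cong (d G u v ℕ.+_) (d-sym x w)) p q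
  ... | cab p q e rewrite e = quadruple u v x w refl (cong (d G u v ℕ.+_) (d-sym x w)) refl p q
  ... | cba p q e rewrite e = quadruple u w x v (cong (d G u x ℕ.+_) (d-sym w v)) (cong (d G u w ℕ.+_) (d-sym x v)) refl p q

  module _ (k : ℕ) (contained : IsometricH3 k G) where

    private
      K = + k
      φ = proj₁ contained

      dist-φ : ∀ p q → Region K p → Region K q → d G (φ p) (φ q) ≡ δ p q
      dist-φ p q hp hq = trans (proj₂ contained p∈ q∈) (H₃-distance.dH3≡δ k p q p∈ q∈)
        where
        p∈ = region⇒∈ k p hp
        q∈ = region⇒∈ k q hq

      D-φ : ∀ {p q} → Region K p → Region K q → D (φ p) (φ q) ≡ + δ p q
      D-φ {p} {q} hp hq = cong +_ (dist-φ p q hp hq)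

      A∈ : Region K (tipA K)
      A∈ = inj₂ (inj₁ (refl , refl))
      B∈ : Region K (tipB K)
      B∈ = inj₂ (inj₂ (inj₁ (refl , refl)))
      C∈ : Region K (tipC K)
      C∈ = inj₂ (inj₂ (inj₂ (inj₁ (refl , refl))))
      D∈ : Region K (tipD K)
      D∈ = inj₂ (inj₂ (inj₂ (inj₂ (refl , refl))))

      K≥0 : + 0 ℤ.≤ K
      K≥0 = +≤+ z≤n

      fact : (F : Expr 1 → Form 1) → valid (con (+ 0) ≼ var (# 0) ⇒ F (var (# 0))) ≡ true → ⟦ F (var (# 0)) ⟧ (K ∷ [])
      fact F ok = valid-sound (con (+ 0) ≼ var (# 0) ⇒ F (var (# 0))) ok _ K≥0

      -- The two ends of the row y = 1 of the core; both lie k + 2 above the bottom tip and k + 1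
      -- below the top tip.
      P Q : Pt
      P = + 0 , + 1
      Q = K ℤ.+ K ℤ.+ + 1 , + 1
      P∈ : Region K P
      P∈ = inj₁ (fact (λ k → coreF k (con (+ 0) , con (+ 1))) refl)
      Q∈ : Region K Q
      Q∈ = inj₁ (fact (λ k → coreF k (k ⊕ k ⊕ con (+ 1) , con (+ 1))) refl)

      near : ∀ {p q} m → Region K p → Region K q → Within m p q → D (φ p) (φ q) ℤ.≤ m
      near {p} {q} m hp hq w = subst (ℤ._≤ m) (sym (D-φ hp hq)) (δ-≤ p q m w)

      span-↑ : ∀ {p q} → Region K p → Region K q → p ↑ q → D (φ p) (φ q) ≡ proj₂ q ℤ.- proj₂ p
      span-↑ {p} {q} hp hq a = trans (D-φ hp hq) (δ-↑ p q a)

      span-↗ : ∀ {p q} → Region K p → Region K q → p ↗ q → D (φ p) (φ q) ≡ proj₁ q ℤ.- proj₁ p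
      span-↗ {p} {q} hp hq a = trans (D-φ hp hq) (δ-↗ p q a)

    slice-of-H₃ : suc (k ℕ.+ k) ≤ τ G
    slice-of-H₃ = slice⇒≤τ {suc (k ℕ.+ k)} (slice {φ (tipA K)} {φ (tipC K)} {φ P} {φ Q} (K ℤ.+ + 2) (K ℤ.+ + 1) (+ 1 ℤ.+ (K ℤ.+ K))
      (near (K ℤ.+ + 2) A∈ P∈ (fact (λ k → within (k ⊕ con (+ 2)) (tipAE k) (con (+ 0) , con (+ 1))) refl))
      (near (K ℤ.+ + 1) P∈ C∈ (fact (λ k → within (k ⊕ con (+ 1)) (con (+ 0) , con (+ 1)) (tipCE k)) refl))
      (near (K ℤ.+ + 2) A∈ Q∈ (fact (λ k → within (k ⊕ con (+ 2)) (tipAE k) (k ⊕ k ⊕ con (+ 1) , con (+ 1))) refl))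
      (near (K ℤ.+ + 1) Q∈ C∈ (fact (λ k → within (k ⊕ con (+ 1)) (k ⊕ k ⊕ con (+ 1) , con (+ 1)) (tipCE k)) refl))
      (subst (ℤ._≤_ _) (sym (span-↑ A∈ C∈ (fact (λ k → up (tipAE k) (tipCE k)) refl)))
        (fact (λ k → (k ⊕ con (+ 2)) ⊕ (k ⊕ con (+ 1)) ≼ proj₂ (tipCE k) ⊖ proj₂ (tipAE k)) refl))
      (subst (ℤ._≤_ _) (sym (span-↗ P∈ Q∈ (fact (λ k → right (con (+ 0) , con (+ 1)) (k ⊕ k ⊕ con (+ 1) , con (+ 1))) refl)))
        (fact (λ k → con (+ 1) ⊕ (k ⊕ k) ≼ (k ⊕ k ⊕ con (+ 1)) ⊖ con (+ 0)) refl)))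

    -- The four tips form a quadrangle with sides k + 2 and diagonals 2k + 3.
    gap-of-H₃ : suc (suc (k ℕ.+ k)) ≤ twoHb G
    gap-of-H₃ = uniform-gap {φ (tipA K)} {φ (tipC K)} {φ (tipB K)} {φ (tipD K)} (k ℕ.+ 2 ℕ.+ (k ℕ.+ 2)) _
      (ℤₚ.+-injective (trans (cong₂ ℤ._+_ (span-↑ A∈ C∈ (fact (λ k → up (tipAE k) (tipCE k)) refl))
                                          (span-↗ B∈ D∈ (fact (λ k → right (tipBE k) (tipDE k)) refl)))
        (fact (λ k → (proj₂ (tipCE k) ⊖ proj₂ (tipAE k)) ⊕ (proj₁ (tipDE k) ⊖ proj₁ (tipBE k)) ≈
                     (k ⊕ con (+ 2)) ⊕ (k ⊕ con (+ 2)) ⊕ (con (+ 2) ⊕ (k ⊕ k))) refl)))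
      (ℤₚ.+-injective (cong₂ ℤ._+_
        (trans (span-↑ A∈ B∈ (fact (λ k → up (tipAE k) (tipBE k)) refl))
          (fact (λ k → proj₂ (tipBE k) ⊖ proj₂ (tipAE k) ≈ k ⊕ con (+ 2)) refl))
        (trans (cong +_ (d-sym _ _)) (trans (span-↑ D∈ C∈ (fact (λ k → up (tipDE k) (tipCE k)) refl))
          (fact (λ k → proj₂ (tipCE k) ⊖ proj₂ (tipDE k) ≈ k ⊕ con (+ 2)) refl)))))
      (ℤₚ.+-injective (cong₂ ℤ._+_
        (trans (span-↗ A∈ D∈ (fact (λ k → right (tipAE k) (tipDE k)) refl))
          (fact (λ k → proj₁ (tipDE k) ⊖ proj₁ (tipAE k) ≈ k ⊕ con (+ 2)) refl))
        (trans (cong +_ (d-sym _ _)) (trans (span-↗ B∈ C∈ (fact (λ k → right (tipBE k) (tipCE k)) refl))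
          (fact (λ k → proj₁ (tipCE k) ⊖ proj₁ (tipBE k) ≈ k ⊕ con (+ 2)) refl)))))

  twoHb≤1+τ : twoHb G ≤ suc (τ G)
  twoHb≤1+τ = twoHb≤ λ u v w x → bound (outcome u v w x)
    where
    bound : ∀ {g} → Outcome g → g ≤ suc (τ G)
    bound (inj₁ h)              = ℕₚ.m≤n⇒m≤1+n h
    -- The copy of H₃ᵏ that blocks a slice of diameter g = 2k + 2 itself contains one of diameter g
    -- - 1.
    bound (inj₂ (k , refl , h)) = s≤s (slice-of-H₃ k h)

  extremal⇒H₃ : twoHb G ≡ suc (τ G) → τ G % 2 ≡ 1 × IsometricH3 ⌊ τ G /2⌋ G
  extremal⇒H₃ p = let u , v , w , x , q = twoHb-attained p in conclude q (outcome u v w x)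
    where
    conclude : ∀ {g} → g ≡ suc (τ G) → Outcome g → τ G % 2 ≡ 1 × IsometricH3 ⌊ τ G /2⌋ G
    conclude refl (inj₁ h) = contradiction h ℕₚ.1+n≰n
    conclude q (inj₂ (k , e , h)) = subst (λ t → t % 2 ≡ 1 × IsometricH3 ⌊ t /2⌋ G)
      (ℕₚ.suc-injective (trans (sym e) q))
      (odd-%2 k , subst (λ i → IsometricH3 i G) (ℕₚ.n≡⌈n+n/2⌉ k) h)

  H₃⇒extremal : τ G % 2 ≡ 1 × IsometricH3 ⌊ τ G /2⌋ G → twoHb G ≡ suc (τ G)
  H₃⇒extremal (odd , h) = ℕₚ.≤-antisym twoHb≤1+τ
    (subst (λ t → suc t ≤ twoHb G) (sym (odd-halves (τ G) odd)) (gap-of-H₃ ⌊ τ G /2⌋ h))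

theorem2 : (G : Graph) → Helly G →
    (τ G ≤ twoHb G × twoHb G ≤ suc (τ G)) ×
    (twoHb G ≡ suc (τ G) ⇔ (τ G % 2 ≡ 1 × IsometricH3 ⌊ τ G /2⌋ G))
theorem2 G helly = (τ≤twoHb , twoHb≤1+τ) , mk⇔ extremal⇒H₃ H₃⇒extremal
  where open HellyGraph G helly
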